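{- Let $\Sigma,\Sigma'$ be finite alphabets with at least two elements, let $C=C(\{C_s\}_{s\in S})\subseteq\Sigma^n$ be a lifted code with $|C_s|=|\Sigma'|$ for all $s\in S$, and let $L\subseteq\Sigma'^S$ be its line code (each $C_s$ being identified with $\Sigma'$ by some bijection). Then: (i) $r(C)=\frac{\gamma\log|\Sigma'|}{\log|\Sigma|}\,r(L)$, where $\gamma:=\frac{|S|}{n}\in\left[\frac{D_{\min}}{k_{\max}},\frac{D_{\max}}{k_{\min}}\right]$. (ii) $\frac{D_{\min}\tilde k}{D_{\max}k_{\max}}\,\delta(L)\le\delta(C)\le\frac{D_{\max}k_{\max}}{D_{\min}k_{\min}}\,\delta(L)$.
   Context: $[n]=\{1,\dots,n\}$; $\mathrm{dist}$ is normalized Hamming distance; for a code $D\subseteq\Sigma^n$, $\delta(D)=\min\{\mathrm{dist}(f,g):f\ne g\in D\}$ ($+\infty$ if $|D|=1$) and $r(D)=\log_{|\Sigma^n|}|D|$. Codes are nonempty. **Lifted code.** $S$ is a collection of subsets of $[n]$ with $\bigcup_{s\in S}s=[n]$ and $C_s\subseteq\Sigma^s$ is a code for each $s\in S$; $C(\{C_s\}_{s\in S})=\{g\in\Sigma^n:g|_s\in C_s\ \forall s\in S\}$ (assumed nonempty). **Line code.** $L=\{(f_s)_{s\in S}\in\prod_{s\in S}C_s:f_s|_{s\cap s'}=f_{s'}|_{s\cap s'}\ \forall s,s'\in S\}$, viewed inside $\Sigma'^S$ via the bijections $C_s\cong\Sigma'$. **Constants.** $k_{\min}=\min_{s\in S}|s|$,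 $k_{\max}=\max_{s\in S}|s|$, $D_{\min}=\min_{i\in[n]}\#\{s\in S:i\in s\}$, $D_{\max}=\max_{i\in[n]}\#\{s\in S:i\in s\}$, $\tilde k=\min_{s\in S}(\delta(C_s)|s|)$. -}

module Defs where

open import Level using (0ℓ)
open import Data.Empty using (⊥-elim)
open import Data.Nat.Base as ℕ using (ℕ; zero; suc; NonZero; NonTrivial; z≤n; s≤s)
import Data.Nat.Properties as ℕ
open import Data.Integer.Base as ℤ using (+_; +[1+_]; -[1+_])
import Data.Integer.Properties as ℤ
open import Data.Rational.Base as ℚ using (ℚ; 0ℚ; mkℚ; *<*; ↥_; ↧ₙ_; _/_)
import Data.Rational.Properties as ℚ
open import Data.Rational.Unnormalised.Base as ℚᵘ using (mkℚᵘ; *≡*)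
import Data.Rational.Unnormalised.Properties as ℚᵘ
open import Data.Fin.Base using (Fin)
open import Data.Fin.Properties using (all?; nonZeroIndex; inj⇒≟)
open import Data.Fin.Subset using (Subset; inside; outside; _∈_; _⊆_; _∩_; ∣_∣)
open import Data.Fin.Subset.Properties using (_∈?_; drop-∷-⊆; p∩q⊆p; p∩q⊆q)
open import Data.Vec.Base as Vec using (Vec; []; _∷_; lookup; tabulate; allFin; count; foldr₁; zip; here)
import Data.Vec.Properties as Vec
open import Data.List.Base as List using (List; length; filter; cartesianProduct; cartesianProductWith)
import Data.List.Properties as List
open import Data.Product.Base using (∃; _×_; _,_; proj₁; proj₂)
open import Function.Base using (_∘_)
open import Function.Bundles using (_↔_; _⇔_; Inverse; Bijection)
open import Function.Properties.Inverse using (↔⇒↣)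
open import Function.Definitions using (Injective)
open import Relation.Nullary using (¬_; yes; no; ¬?)
open import Relation.Nullary.Construct.Add.Supremum public using (_⁺; ⊤⁺; [_])
open import Relation.Binary.Construct.Add.Supremum.NonStrict ℚ._≤_ public using (_≤⁺_)
import Relation.Binary.Construct.On as On
open import Relation.Binary.Bundles using (Setoid)
open import Relation.Binary.Definitions using (DecidableEquality)
open import Relation.Binary.PropositionalEquality
open import Relation.Unary using (Pred; Decidable; Satisfiable)

-- One-sided Dedekind cuts: a real x ≥ 0 is the set {q ∈ ℚ | 0 < q < x};
-- in particular 0 is the empty cut.
record ℝ≥0 : Set₁ where
  field
    Below    : ℚ → Set
    positive : ∀ {q} → Below q → 0ℚ ℚ.< q
    downward : ∀ {p q} → 0ℚ ℚ.< p → p ℚ.≤ q → Below q → Below p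
    open′    : ∀ {q} → Below q → ∃ λ r → q ℚ.< r × Below r
    bounded  : ∃ λ B → ∀ {q} → Below q → q ℚ.< B

open ℝ≥0

infix 4 _≈_
_≈_ : ℝ≥0 → ℝ≥0 → Set
x ≈ y = ∀ q → Below x q ⇔ Below y q

*-pos : ∀ {p q} → 0ℚ ℚ.< p → 0ℚ ℚ.< q → 0ℚ ℚ.< p ℚ.* q
*-pos {p} {q} 0<p 0<q =
  subst (ℚ._< p ℚ.* q) (ℚ.*-zeroʳ p) (ℚ.*-monoʳ-<-pos p {{ℚ.positive 0<p}} 0<q)

*-mono-<-< : ∀ {p p′ q q′} → 0ℚ ℚ.< q → 0ℚ ℚ.< p′ →
             p ℚ.< p′ → q ℚ.< q′ → p ℚ.* q ℚ.< p′ ℚ.* q′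
*-mono-<-< {p} {p′} {q} {q′} 0<q 0<p′ p<p′ q<q′ = ℚ.<-trans
  (ℚ.*-monoˡ-<-pos q {{ℚ.positive 0<q}} p<p′)
  (ℚ.*-monoʳ-<-pos p′ {{ℚ.positive 0<p′}} q<q′)

-- Used for γ > 0 only; x ≤ 0 is sent to 0.
fromℚ : ℚ → ℝ≥0
fromℚ x = record
  { Below    = λ q → 0ℚ ℚ.< q × q ℚ.< x
  ; positive = proj₁
  ; downward = λ 0<p p≤q q<x → 0<p , ℚ.≤-<-trans p≤q (proj₂ q<x)
  ; open′    = λ (0<q , q<x) → let r , q<r , r<x = ℚ.<-dense q<x in
                 r , q<r , ℚ.<-trans 0<q q<r , r<x
  ; bounded  = x , proj₂
  }

infixl 7 _·_ _÷_[_]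

_·_ : ℝ≥0 → ℝ≥0 → ℝ≥0
x · y = record
  { Below    = λ q → 0ℚ ℚ.< q × ∃ λ a → ∃ λ b → Below x a × Below y b × q ℚ.≤ a ℚ.* b
  ; positive = proj₁
  ; downward = λ (0<p) p≤q (_ , a , b , a∈x , b∈y , q≤ab) →
                 0<p , a , b , a∈x , b∈y , ℚ.≤-trans p≤q q≤ab
  ; open′    = λ (_ , a , b , a∈x , b∈y , q≤ab) →
      let a′ , a<a′ , a′∈x = open′ x a∈x
          b′ , b<b′ , b′∈y = open′ y b∈y
          0<a′ = positive x a′∈x
          0<b′ = positive y b′∈y
      in a′ ℚ.* b′
       , ℚ.≤-<-trans q≤ab (*-mono-<-< (positive y b∈y) 0<a′ a<a′ b<b′)
       , *-pos 0<a′ 0<b′ , a′ , b′ , a′∈x , b′∈y , ℚ.≤-refl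
  ; bounded  =
      let A , <A = bounded x
          B , <B = bounded y
      in A ℚ.* B , λ (_ , a , b , a∈x , b∈y , q≤ab) →
           ℚ.≤-<-trans q≤ab (*-mono-<-< (positive y b∈y)
             (ℚ.<-trans (positive x a∈x) (<A a∈x)) (<A a∈x) (<B b∈y))
  }

-- Division by y > 0, witnessed by a rational strictly between 0 and y:
-- q < x / y iff q b < x for some rational b ≥ y.
_÷_[_] : (x y : ℝ≥0) → ∃ (Below y) → ℝ≥0
x ÷ y [ e , e∈y ] = record
  { Below    = Quot
  ; positive = proj₁
  ; downward = λ {p} {q} 0<p p≤q (_ , b , 0<b , b∉y , qb∈x) →
      0<p , b , 0<b , b∉y ,
      downward x (*-pos 0<p 0<b)
        (ℚ.*-monoʳ-≤-nonNeg b {{ℚ.pos⇒nonNeg b {{ℚ.positive 0<b}}}} p≤q) qb∈x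
  ; open′    = λ {q} → up {q}
  ; bounded  =
      let B , <B = bounded x in
      B ℚ.* e⁻¹ , λ {q} (0<q , b , 0<b , b∉y , qb∈x) →
        let e<b : e ℚ.< b
            e<b = ℚ.≰⇒> (λ b≤e → b∉y (downward y 0<b b≤e e∈y))
            qe<B : q ℚ.* e ℚ.< B
            qe<B = ℚ.<-trans (ℚ.*-monoʳ-<-pos q {{ℚ.positive 0<q}} e<b) (<B qb∈x)
        in subst (ℚ._< B ℚ.* e⁻¹) (cancel q e {{e≢0}})
             (ℚ.*-monoˡ-<-pos e⁻¹ {{ℚ.1/pos⇒pos e {{e>0}}}} qe<B)
  }
  where
  Quot : ℚ → Set
  Quot q = 0ℚ ℚ.< q × ∃ λ b → 0ℚ ℚ.< b × ¬ Below y b × Below x (q ℚ.* b)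

  e>0 : ℚ.Positive e
  e>0 = ℚ.positive (positive y e∈y)

  e≢0 : ℚ.NonZero e
  e≢0 = ℚ.pos⇒nonZero e {{e>0}}

  e⁻¹ : ℚ
  e⁻¹ = (ℚ.1/ e) {{e≢0}}

  cancel : ∀ q e .{{_ : ℚ.NonZero e}} → q ℚ.* e ℚ.* (ℚ.1/ e) ≡ q
  cancel q e = trans (ℚ.*-assoc q e _)
    (trans (cong (q ℚ.*_) (ℚ.*-inverseʳ e)) (ℚ.*-identityʳ q))

  cancel′ : ∀ q e .{{_ : ℚ.NonZero e}} → q ℚ.* (ℚ.1/ e) ℚ.* e ≡ q
  cancel′ q e = trans (ℚ.*-assoc q _ e)
    (trans (cong (q ℚ.*_) (ℚ.*-inverseˡ e)) (ℚ.*-identityʳ q))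

  up : ∀ {q} → Quot q → ∃ λ r → q ℚ.< r × Quot r
  up {q} (_ , b , 0<b , b∉y , qb∈x) =
    let instance
          b>0 : ℚ.Positive b
          b>0 = ℚ.positive 0<b
          b≢0 : ℚ.NonZero b
          b≢0 = ℚ.pos⇒nonZero b
          1/b>0 : ℚ.Positive (ℚ.1/ b)
          1/b>0 = ℚ.1/pos⇒pos b
        a , qb<a , a∈x = open′ x qb∈x
    in a ℚ.* (ℚ.1/ b)
     , subst (ℚ._< a ℚ.* (ℚ.1/ b)) (cancel q b) (ℚ.*-monoˡ-<-pos (ℚ.1/ b) qb<a)
     , *-pos (positive x a∈x) (ℚ.positive⁻¹ (ℚ.1/ b))
     , b , 0<b , b∉y , subst (Below x) (sym (cancel′ a b)) a∈x

base-cancel-< : ∀ {x y} d → x ℕ.^ d ℕ.< y ℕ.^ d → x ℕ.< y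
base-cancel-< d lt = ℕ.≰⇒> (λ y≤x → ℕ.<⇒≱ lt (ℕ.^-monoˡ-≤ d y≤x))

exp-cancel-< : ∀ b .{{_ : NonZero b}} {p q} → b ℕ.^ p ℕ.< b ℕ.^ q → p ℕ.< q
exp-cancel-< b lt = ℕ.≰⇒> (λ q≤p → ℕ.<⇒≱ lt (ℕ.^-monoʳ-≤ b q≤p))

-- b^(P/D) < a and p/d ≤ P/D give b^(p/d) < a.
pow-< : ∀ b .{{_ : NonZero b}} a {P D p d} .{{_ : NonZero d}} →
        p ℕ.* D ℕ.≤ P ℕ.* d → b ℕ.^ P ℕ.< a ℕ.^ D → b ℕ.^ p ℕ.< a ℕ.^ d
pow-< b a {P} {D} {p} {d} le lt = base-cancel-< D (begin-strict
  (b ℕ.^ p) ℕ.^ D  ≡⟨ ℕ.^-*-assoc b p D ⟩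
  b ℕ.^ (p ℕ.* D)  ≤⟨ ℕ.^-monoʳ-≤ b le ⟩
  b ℕ.^ (P ℕ.* d)  ≡⟨ ℕ.^-*-assoc b P d ⟨
  (b ℕ.^ P) ℕ.^ d  <⟨ ℕ.^-monoˡ-< d lt ⟩
  (a ℕ.^ D) ℕ.^ d  ≡⟨ ℕ.^-*-assoc a D d ⟩
  a ℕ.^ (D ℕ.* d)  ≡⟨ cong (a ℕ.^_) (ℕ.*-comm D d) ⟩
  a ℕ.^ (d ℕ.* D)  ≡⟨ ℕ.^-*-assoc a d D ⟨
  (a ℕ.^ d) ℕ.^ D  ∎)
  where open ℕ.≤-Reasoning

n<b^n : ∀ b → 1 ℕ.< b → ∀ n → n ℕ.< b ℕ.^ n
n<b^n b 1<b zero    = ℕ.≤-refl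
n<b^n b 1<b (suc n) = ℕ.<-≤-trans (s≤s (n<b^n b 1<b n)) (begin
  suc (b ℕ.^ n)           ≤⟨ ℕ.+-monoˡ-≤ (b ℕ.^ n) (ℕ.≤-<-trans z≤n (n<b^n b 1<b n)) ⟩
  b ℕ.^ n ℕ.+ b ℕ.^ n     ≡⟨ cong (b ℕ.^ n ℕ.+_) (ℕ.+-identityʳ (b ℕ.^ n)) ⟨
  2 ℕ.* b ℕ.^ n           ≤⟨ ℕ.*-monoˡ-≤ (b ℕ.^ n) 1<b ⟩
  b ℕ.* b ℕ.^ n           ∎)
  where open ℕ.≤-Reasoning

bernoulli : ∀ x N → x ℕ.^ N ℕ.* x ℕ.+ N ℕ.* x ℕ.^ N ℕ.≤ suc x ℕ.^ N ℕ.* x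
bernoulli x zero    = ℕ.≤-reflexive (ℕ.+-identityʳ (1 ℕ.* x))
bernoulli x (suc N) = begin
  x ℕ.* X ℕ.* x ℕ.+ (x ℕ.* X ℕ.+ N ℕ.* (x ℕ.* X))
    ≡⟨ cong (ℕ._+ (x ℕ.* X ℕ.+ N ℕ.* (x ℕ.* X))) (ℕ.*-assoc x X x) ⟩
  x ℕ.* (X ℕ.* x) ℕ.+ (x ℕ.* X ℕ.+ N ℕ.* (x ℕ.* X))
    ≡⟨ cong₂ (λ u v → x ℕ.* (X ℕ.* x) ℕ.+ (u ℕ.+ v)) (ℕ.*-comm x X) lemma ⟩
  x ℕ.* (X ℕ.* x) ℕ.+ (X ℕ.* x ℕ.+ x ℕ.* (N ℕ.* X))
    ≡⟨ ℕ.+-assoc (x ℕ.* (X ℕ.* x)) (X ℕ.* x) _ ⟨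
  x ℕ.* (X ℕ.* x) ℕ.+ X ℕ.* x ℕ.+ x ℕ.* (N ℕ.* X)
    ≡⟨ cong (ℕ._+ x ℕ.* (N ℕ.* X)) (ℕ.+-comm (x ℕ.* (X ℕ.* x)) (X ℕ.* x)) ⟩
  X ℕ.* x ℕ.+ x ℕ.* (X ℕ.* x) ℕ.+ x ℕ.* (N ℕ.* X)
    ≡⟨ ℕ.+-assoc (X ℕ.* x) _ _ ⟩
  X ℕ.* x ℕ.+ (x ℕ.* (X ℕ.* x) ℕ.+ x ℕ.* (N ℕ.* X))
    ≡⟨ cong (X ℕ.* x ℕ.+_) (ℕ.*-distribˡ-+ x (X ℕ.* x) (N ℕ.* X)) ⟨
  X ℕ.* x ℕ.+ x ℕ.* (X ℕ.* x ℕ.+ N ℕ.* X)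
    ≤⟨ ℕ.+-mono-≤ (ℕ.≤-trans (ℕ.m≤m+n (X ℕ.* x) (N ℕ.* X)) (bernoulli x N))
                  (ℕ.*-monoʳ-≤ x (bernoulli x N)) ⟩
  Y ℕ.* x ℕ.+ x ℕ.* (Y ℕ.* x)
    ≡⟨ ℕ.*-assoc (suc x) Y x ⟨
  suc x ℕ.* Y ℕ.* x ∎
  where
  open ℕ.≤-Reasoning
  X = x ℕ.^ N
  Y = suc x ℕ.^ N
  lemma : N ℕ.* (x ℕ.* X) ≡ x ℕ.* (N ℕ.* X)
  lemma = trans (sym (ℕ.*-assoc N x X))
    (trans (cong (ℕ._* X) (ℕ.*-comm N x)) (ℕ.*-assoc x N X))

-- A strict inequality x < y leaves room for a factor b after taking a power.
slack : ∀ b x y .{{_ : NonZero x}} → x ℕ.< y →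
        b ℕ.* x ℕ.^ (b ℕ.* x) ℕ.< y ℕ.^ (b ℕ.* x)
slack b x y x<y = ℕ.*-cancelʳ-< _ _ _ (begin-strict
  b ℕ.* X ℕ.* x                ≡⟨ trans (ℕ.*-assoc b X x)
                                    (trans (cong (b ℕ.*_) (ℕ.*-comm X x)) (sym (ℕ.*-assoc b x X))) ⟩
  N ℕ.* X                      <⟨ ℕ.+-monoˡ-< (N ℕ.* X)
                                    (ℕ.>-nonZero⁻¹ (X ℕ.* x) {{ℕ.m*n≢0 X x {{ℕ.m^n≢0 x N}}}}) ⟩
  X ℕ.* x ℕ.+ N ℕ.* X          ≤⟨ bernoulli x N ⟩
  suc x ℕ.^ N ℕ.* x            ≤⟨ ℕ.*-monoˡ-≤ x (ℕ.^-monoˡ-≤ N x<y) ⟩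
  y ℕ.^ N ℕ.* x                ∎)
  where
  open ℕ.≤-Reasoning
  N = b ℕ.* x
  X = x ℕ.^ N

-- log_b a for a ≥ 1: p/d < log_b a iff b^p < a^d.  (The argument a = 0, which
-- does not occur for nonempty codes, would yield the empty cut.)
log : (b : ℕ) .{{_ : NonTrivial b}} → ℕ → ℝ≥0
log b a = record
  { Below    = Lg
  ; positive = proj₁
  ; downward = λ {p} {q} → down {p} {q}
  ; open′    = λ {q} → up {q}
  ; bounded  = + a / 1 , λ {q} → bd {q}
  }
  where
  Lg : ℚ → Set
  Lg q = 0ℚ ℚ.< q × b ℕ.^ ℤ.∣ ↥ q ∣ ℕ.< a ℕ.^ ↧ₙ q

  instance
    b≢0 : NonZero b
    b≢0 = ℕ.nonTrivial⇒nonZero b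

  1<b : 1 ℕ.< b
  1<b = ℕ.nonTrivial⇒n>1 b

  down : ∀ {p q} → 0ℚ ℚ.< p → p ℚ.≤ q → Lg q → Lg p
  down {mkℚ +[1+ m ] d _} {mkℚ +[1+ k ] e _} 0<p (ℚ.*≤* le) (_ , lt) =
    0<p , pow-< b a {suc k} {suc e} {suc m} {suc d} (ℤ.drop‿+≤+ le) lt
  down {mkℚ (+ 0) _ _} (*<* (ℤ.+<+ ()))
  down {mkℚ -[1+ _ ] _ _} (*<* ())
  down {q = mkℚ (+ 0) _ _} _ _ (*<* (ℤ.+<+ ()) , _)
  down {q = mkℚ -[1+ _ ] _ _} _ _ (*<* () , _)

  bd : ∀ {q} → Lg q → q ℚ.< + a / 1
  bd {q@(mkℚ (+ k) e _)} (_ , lt) = ℚ.toℚᵘ-cancel-<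
    (ℚᵘ.<-respʳ-≃ (ℚᵘ.≃-sym (ℚ.toℚᵘ-fromℚᵘ (mkℚᵘ (+ a) 0)))
      (ℚᵘ.*<* (subst₂ ℤ._<_ (ℤ.pos-* k 1) (ℤ.pos-* a (suc e)) (ℤ.+<+ k<ae))))
    where
    open ℕ.≤-Reasoning
    k<ae : k ℕ.* 1 ℕ.< a ℕ.* suc e
    k<ae = exp-cancel-< b (begin-strict
      b ℕ.^ (k ℕ.* 1)       ≡⟨ cong (b ℕ.^_) (ℕ.*-identityʳ k) ⟩
      b ℕ.^ k               <⟨ lt ⟩
      a ℕ.^ suc e           ≤⟨ ℕ.^-monoˡ-≤ (suc e) (ℕ.<⇒≤ (n<b^n b 1<b a)) ⟩
      (b ℕ.^ a) ℕ.^ suc e   ≡⟨ ℕ.^-*-assoc b a (suc e) ⟩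
      b ℕ.^ (a ℕ.* suc e)   ∎)
  bd {mkℚ -[1+ _ ] _ _} (*<* () , _)

  up : ∀ {q} → Lg q → ∃ λ r → q ℚ.< r × Lg r
  up {mkℚ -[1+ _ ] _ _} (*<* () , _)
  up {q@(mkℚ (+ k) e _)} (0<q , lt) = r , q<r , ℚ.<-trans 0<q q<r , lg r r≃
    where
    x = b ℕ.^ k
    y = a ℕ.^ suc e
    instance
      x≢0 : NonZero x
      x≢0 = ℕ.m^n≢0 b k
      N≢0 : NonZero (b ℕ.* x)
      N≢0 = ℕ.m*n≢0 b x
      D≢0 : NonZero (suc e ℕ.* (b ℕ.* x))
      D≢0 = ℕ.m*n≢0 (suc e) (b ℕ.* x)
    N = b ℕ.* x
    P = suc (k ℕ.* N)
    D = suc e ℕ.* N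

    big : b ℕ.^ P ℕ.< a ℕ.^ D
    big = subst₂ ℕ._<_ (cong (b ℕ.*_) (ℕ.^-*-assoc b k N)) (ℕ.^-*-assoc a (suc e) N)
            (slack b x y lt)

    u = mkℚᵘ (+ P) (ℕ.pred D)
    r = ℚ.fromℚᵘ u
    r≃ = ℚ.toℚᵘ-fromℚᵘ u

    sucpred : suc (ℕ.pred D) ≡ D
    sucpred = ℕ.suc-pred D

    kD<Pe : k ℕ.* suc (ℕ.pred D) ℕ.< P ℕ.* suc e
    kD<Pe = begin-strict
      k ℕ.* suc (ℕ.pred D)      ≡⟨ cong (k ℕ.*_) (trans sucpred (ℕ.*-comm (suc e) N)) ⟩
      k ℕ.* (N ℕ.* suc e)       ≡⟨ ℕ.*-assoc k N (suc e) ⟨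
      k ℕ.* N ℕ.* suc e         <⟨ ℕ.*-monoˡ-< (suc e) (ℕ.n<1+n (k ℕ.* N)) ⟩
      P ℕ.* suc e               ∎
      where open ℕ.≤-Reasoning

    q<r : q ℚ.< r
    q<r = ℚ.toℚᵘ-cancel-< (ℚᵘ.<-respʳ-≃ (ℚᵘ.≃-sym r≃)
      (ℚᵘ.*<* (subst₂ ℤ._<_ (ℤ.pos-* k (suc (ℕ.pred D))) (ℤ.pos-* P (suc e)) (ℤ.+<+ kD<Pe))))

    lg : ∀ r → ℚ.toℚᵘ r ℚᵘ.≃ u → b ℕ.^ ℤ.∣ ↥ r ∣ ℕ.< a ℕ.^ ↧ₙ r
    lg r@(mkℚ i d _) (*≡* eq) = pow-< b a {P} {D} {ℤ.∣ i ∣} {suc d} (ℕ.≤-reflexive (begin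
      ℤ.∣ i ∣ ℕ.* D                       ≡⟨ cong (ℤ.∣ i ∣ ℕ.*_) sucpred ⟨
      ℤ.∣ i ∣ ℕ.* suc (ℕ.pred D)          ≡⟨ ℤ.abs-* i (+ suc (ℕ.pred D)) ⟨
      ℤ.∣ i ℤ.* + suc (ℕ.pred D) ∣        ≡⟨ cong ℤ.∣_∣ eq ⟩
      ℤ.∣ + P ℤ.* + suc d ∣               ≡⟨ ℤ.abs-* (+ P) (+ suc d) ⟩
      P ℕ.* suc d                         ∎)) big
      where open ≡-Reasoning

-- Quotients log a / log b do not depend on the base of log; base 2 is used for them.
log₂-pos : ∀ a .{{_ : NonTrivial a}} → ∃ (Below (log 2 a))
log₂-pos a = + 1 / 2 , *<* (ℤ.+<+ (s≤s z≤n)) , (begin-strict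
  2                <⟨ s≤s (s≤s (s≤s z≤n)) ⟩
  2 ℕ.^ 2          ≤⟨ ℕ.^-monoˡ-≤ 2 (ℕ.nonTrivial⇒n>1 a) ⟩
  a ℕ.^ 2          ∎)
  where open ℕ.≤-Reasoning

infixl 7 _*⁺_

-- ℚ ⁺ is ℚ ∪ {+∞}, with ⊤⁺ for +∞.  All factors that occur are positive, so 0 · ∞ never arises.
_*⁺_ : ℚ ⁺ → ℚ ⁺ → ℚ ⁺
[ p ] *⁺ [ q ] = [ p ℚ.* q ]
[ _ ] *⁺ ⊤⁺    = ⊤⁺
⊤⁺    *⁺ _     = ⊤⁺

infixl 7 _⊓⁺_

_⊓⁺_ : ℚ ⁺ → ℚ ⁺ → ℚ ⁺
[ p ] ⊓⁺ [ q ] = [ p ℚ.⊓ q ]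
[ p ] ⊓⁺ ⊤⁺    = [ p ]
⊤⁺    ⊓⁺ y     = y

min⁺ : List (ℚ ⁺) → ℚ ⁺
min⁺ = List.foldr _⊓⁺_ ⊤⁺

minimum maximum : ∀ {k} .{{_ : NonZero k}} → (Fin k → ℕ) → ℕ
minimum {suc _} f = foldr₁ ℕ._⊓_ (tabulate f)
maximum {suc _} f = foldr₁ ℕ._⊔_ (tabulate f)

module _ {_∙_ : ℕ → ℕ → ℕ} (pres : ∀ {a b} → 0 ℕ.< a → 0 ℕ.< b → 0 ℕ.< a ∙ b) where
  foldr₁-pos : ∀ {k} (f : Fin (suc k) → ℕ) → (∀ i → 0 ℕ.< f i) →
               0 ℕ.< foldr₁ _∙_ (tabulate f)
  foldr₁-pos {zero}  f pos = pos Fin.zero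
  foldr₁-pos {suc k} f pos = pres (pos Fin.zero) (foldr₁-pos (f ∘ Fin.suc) (pos ∘ Fin.suc))

minimum≢0 : ∀ {k} .{{_ : NonZero k}} (f : Fin k → ℕ) → (∀ i → 0 ℕ.< f i) → NonZero (minimum f)
minimum≢0 {suc _} f pos = ℕ.>-nonZero (foldr₁-pos ℕ.⊓-glb f pos)

maximum≢0 : ∀ {k} .{{_ : NonZero k}} (f : Fin k → ℕ) → (∀ i → 0 ℕ.< f i) → NonZero (maximum f)
maximum≢0 {suc _} f pos = ℕ.>-nonZero (foldr₁-pos (λ {a} {b} 0<a _ → ℕ.<-≤-trans 0<a (ℕ.m≤m⊔n a b)) f pos)

record Alphabet : Set₁ where
  field
    Letter      : Set
    size        : ℕ
    enumeration : Letter ↔ Fin size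
    {{size≥2}}  : NonTrivial size

  infix 4 _≟_
  _≟_ : DecidableEquality Letter
  _≟_ = inj⇒≟ (↔⇒↣ enumeration)

  Word : ℕ → Set
  Word = Vec Letter

  _≟ʷ_ : ∀ {k} → DecidableEquality (Word k)
  _≟ʷ_ = Vec.≡-dec _≟_

  words : ∀ k → List (Word k)
  words zero    = [] List.∷ List.[]
  words (suc k) = cartesianProductWith _∷_
                    (List.map (Inverse.from enumeration) (List.allFin size)) (words k)

  dist : ∀ {k} .{{_ : NonZero k}} → Word k → Word k → ℚ
  dist {k} f g = + count (λ (x , y) → ¬? (x ≟ y)) (zip f g) / k

open Alphabet public using (size)

record Code (𝔸 : Alphabet) (k : ℕ) : Set₁ where
  open Alphabet 𝔸
  field
    Member   : Pred (Word k) 0ℓ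
    member?  : Decidable Member
    nonempty : Satisfiable Member

  codewords : List (Word k)
  codewords = filter member? (words k)

  card : ℕ
  card = length codewords

  codeSetoid : Setoid 0ℓ 0ℓ
  codeSetoid = On.setoid {B = ∃ Member} (setoid (Word k)) proj₁

open Code public using (Member; card)

δ : ∀ {𝔸 k} .{{_ : NonZero k}} → Code 𝔸 k → ℚ ⁺
δ {𝔸} D = min⁺ (List.map (λ (f , g) → [ dist f g ])
                  (filter (λ (f , g) → ¬? (f ≟ʷ g)) (cartesianProduct codewords codewords)))
  where
  open Alphabet 𝔸
  open Code D

^-nonTrivial : ∀ b k .{{_ : NonTrivial b}} .{{_ : NonZero k}} → NonTrivial (b ℕ.^ k)
^-nonTrivial b (suc k) = ℕ.n>1⇒nonTrivial (ℕ.^-monoʳ-< b (ℕ.nonTrivial⇒n>1 b) {0} {suc k} (s≤s z≤n))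

rate : ∀ {𝔸 k} .{{_ : NonZero k}} → Code 𝔸 k → ℝ≥0
rate {𝔸} {k} D = log (size 𝔸 ℕ.^ k) {{^-nonTrivial (size 𝔸) k}} (card D)

length≢0 : ∀ {𝔸 k} (D : Code 𝔸 k) → 1 ℕ.< card D → 0 ℕ.< k
length≢0 {k = zero}  D 1<card =
  ⊥-elim (ℕ.<⇒≱ 1<card (List.length-filter (Code.member? D) ([] List.∷ List.[])))
length≢0 {k = suc _} D _      = s≤s z≤n

-- For s ⊆ [n], Σ^s is Vec Σ ∣ s ∣: the values at the elements of s, listed in
-- increasing order of the elements.
module _ {A : Set} where

  infixl 8 _↾_
  _↾_ : ∀ {n} → Vec A n → (s : Subset n) → Vec A ∣ s ∣
  []       ↾ []            = []
  (x ∷ xs) ↾ (inside  ∷ s) = x ∷ xs ↾ s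
  (x ∷ xs) ↾ (outside ∷ s) = xs ↾ s

  restrict : ∀ {n} (s t : Subset n) → t ⊆ s → Vec A ∣ s ∣ → Vec A ∣ t ∣
  restrict []            []            _   []       = []
  restrict (inside  ∷ s) (inside  ∷ t) t⊆s (x ∷ xs) = x ∷ restrict s t (drop-∷-⊆ t⊆s) xs
  restrict (inside  ∷ s) (outside ∷ t) t⊆s (x ∷ xs) = restrict s t (drop-∷-⊆ t⊆s) xs
  restrict (outside ∷ s) (outside ∷ t) t⊆s xs       = restrict s t (drop-∷-⊆ t⊆s) xs
  restrict (outside ∷ s) (inside  ∷ t) t⊆s xs       with () ← t⊆s here

  restrict-↾ : ∀ {n} (s t : Subset n) (t⊆s : t ⊆ s) (g : Vec A n) →
               restrict s t t⊆s (g ↾ s) ≡ g ↾ t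
  restrict-↾ []            []            _   []      = refl
  restrict-↾ (inside  ∷ s) (inside  ∷ t) t⊆s (x ∷ g) = cong (x ∷_) (restrict-↾ s t (drop-∷-⊆ t⊆s) g)
  restrict-↾ (inside  ∷ s) (outside ∷ t) t⊆s (x ∷ g) = restrict-↾ s t (drop-∷-⊆ t⊆s) g
  restrict-↾ (outside ∷ s) (outside ∷ t) t⊆s (x ∷ g) = restrict-↾ s t (drop-∷-⊆ t⊆s) g
  restrict-↾ (outside ∷ s) (inside  ∷ t) t⊆s (x ∷ g) with () ← t⊆s here

-- The collection S is enumerated without repetition as S 0, …, S (∣S∣ - 1), and
-- is itself identified with its index set Fin ∣S∣.
record Lifting (𝔸 𝔹 : Alphabet) (n : ℕ) .{{n≢0 : NonZero n}} : Set₁ where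
  open Alphabet 𝔸 using (Word; _≟ʷ_)
  field
    ∣S∣         : ℕ
    S           : Fin ∣S∣ → Subset n
    S-injective : Injective _≡_ _≡_ S
    S-covers    : ∀ i → ∃ λ s → i ∈ S s
    Cₛ          : ∀ s → Code 𝔸 ∣ S s ∣
    card-Cₛ     : ∀ s → card (Cₛ s) ≡ size 𝔹

  LiftedWord : Pred (Word n) 0ℓ
  LiftedWord g = ∀ s → Member (Cₛ s) (g ↾ S s)

  field
    lifted-nonempty : Satisfiable LiftedWord

  C : Code 𝔸 n
  C = record
    { Member   = LiftedWord
    ; member?  = λ g → all? (λ s → Code.member? (Cₛ s) (g ↾ S s))
    ; nonempty = lifted-nonempty
    }

  Compatible : (∀ s → ∃ (Member (Cₛ s))) → Set
  Compatible f = ∀ s s′ →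
    restrict (S s)  (S s ∩ S s′) (p∩q⊆p (S s) (S s′)) (proj₁ (f s)) ≡
    restrict (S s′) (S s ∩ S s′) (p∩q⊆q (S s) (S s′)) (proj₁ (f s′))

  -- Bijections between 𝔹 and each Cₛ; elements of Cₛ are equal when the underlying
  -- words are.
  Identification : Set
  Identification = ∀ s → Bijection (setoid (Alphabet.Letter 𝔹)) (Code.codeSetoid (Cₛ s))

  module _ (φ : Identification) where

    family : Alphabet.Word 𝔹 ∣S∣ → ∀ s → ∃ (Member (Cₛ s))
    family w s = Bijection.to (φ s) (lookup w s)

    L : Code 𝔹 ∣S∣
    L = record
      { Member   = λ w → Compatible (family w)
      ; member?  = λ w → all? λ s → all? λ s′ → _ ≟ʷ _
      ; nonempty = tabulate w₀ , compat
      }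
      where
      g₀  = proj₁ lifted-nonempty
      g₀∈ = proj₂ lifted-nonempty

      w₀ : Fin ∣S∣ → Alphabet.Letter 𝔹
      w₀ s = proj₁ (Bijection.surjective (φ s) (g₀ ↾ S s , g₀∈ s))

      fam : ∀ s → proj₁ (family (tabulate w₀) s) ≡ g₀ ↾ S s
      fam s = proj₂ (Bijection.surjective (φ s) (g₀ ↾ S s , g₀∈ s)) (Vec.lookup∘tabulate w₀ s)

      compat : Compatible (family (tabulate w₀))
      compat s s′ = trans (cong (restrict (S s) (S s ∩ S s′) (p∩q⊆p (S s) (S s′))) (fam s))
        (trans (restrict-↾ _ _ (p∩q⊆p (S s) (S s′)) g₀)
        (sym (trans (cong (restrict (S s′) (S s ∩ S s′) (p∩q⊆q (S s) (S s′))) (fam s′))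
                    (restrict-↾ _ _ (p∩q⊆q (S s) (S s′)) g₀))))

  index : ∀ {m} .{{_ : NonZero m}} → Fin m
  index {suc _} = Fin.zero

  instance
    ∣S∣≢0 : NonZero ∣S∣
    ∣S∣≢0 = nonZeroIndex (proj₁ (S-covers (index {n})))

  ∣s∣>0 : ∀ s → 0 ℕ.< ∣ S s ∣
  ∣s∣>0 s = length≢0 (Cₛ s)
    (subst (1 ℕ.<_) (sym (card-Cₛ s)) (ℕ.nonTrivial⇒n>1 (size 𝔹)))

  instance
    ∣s∣≢0 : ∀ {s} → NonZero ∣ S s ∣
    ∣s∣≢0 {s} = ℕ.>-nonZero (∣s∣>0 s)

  degree : Fin n → ℕ
  degree i = count (λ s → i ∈? S s) (allFin ∣S∣)

  kₘᵢₙ kₘₐₓ Dₘᵢₙ Dₘₐₓ : ℕ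
  kₘᵢₙ = minimum (λ s → ∣ S s ∣)
  kₘₐₓ = maximum (λ s → ∣ S s ∣)
  Dₘᵢₙ = minimum degree
  Dₘₐₓ = maximum degree

  k̃ : ℚ ⁺
  k̃ = min⁺ (List.tabulate λ s → δ (Cₛ s) *⁺ [ + ∣ S s ∣ / 1 ])

  γ : ℚ
  γ = + ∣S∣ / n

  degree>0 : ∀ i → 0 ℕ.< degree i
  degree>0 i = let s , i∈s = S-covers i in
    count>0 (allFin ∣S∣) s (subst (λ s → i ∈ S s) (sym (Vec.lookup-allFin s)) i∈s)
    where
    count>0 : ∀ {m} (v : Vec (Fin ∣S∣) m) j → i ∈ S (lookup v j) → 0 ℕ.< count (λ s → i ∈? S s) v
    count>0 (x ∷ v) j i∈ with i ∈? S x
    count>0 (x ∷ v) j           i∈ | yes _  = s≤s z≤n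
    count>0 (x ∷ v) Fin.zero    i∈ | no i∉x = ⊥-elim (i∉x i∈)
    count>0 (x ∷ v) (Fin.suc j) i∈ | no _   = count>0 v j i∈

  instance
    kₘᵢₙ≢0 : NonZero kₘᵢₙ
    kₘᵢₙ≢0 = minimum≢0 _ ∣s∣>0

    kₘₐₓ≢0 : NonZero kₘₐₓ
    kₘₐₓ≢0 = maximum≢0 _ ∣s∣>0

    Dₘₐₓkₘₐₓ≢0 : NonZero (Dₘₐₓ ℕ.* kₘₐₓ)
    Dₘₐₓkₘₐₓ≢0 = ℕ.m*n≢0 Dₘₐₓ kₘₐₓ {{maximum≢0 _ degree>0}}

    Dₘᵢₙkₘᵢₙ≢0 : NonZero (Dₘᵢₙ ℕ.* kₘᵢₙ)
    Dₘᵢₙkₘᵢₙ≢0 = ℕ.m*n≢0 Dₘᵢₙ kₘᵢₙ {{minimum≢0 _ degree>0}}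

{-# OPTIONS --safe #-}

-- C and L correspond bijectively: a codeword of C restricts to a compatible family
-- of local codewords, and a compatible family glues because S covers [n].  Hence
-- |C| = |L|, and the rate identity is a change of base of logarithms.  Since log is
-- a cut of rationals, the change of base is proved by inserting, between two powers
-- A^p < B^q, a power of 2 at the cost of raising both to a common exponent.
--
-- For the rest, count incidences i ∈ s in two ways.  Unweighted this bounds γ.
-- Weighted by the coordinates where two codewords f, g of C differ, it compares
-- dist(f, g) with the number of s on which f and g differ: such an s contributes at
-- most kₘₐₓ and at least δ(Cₛ)|s| ≥ k̃ differing coordinates, the others none.

module Submission where

open import Defs
open import Level using (0ℓ)
open import Data.Bool.Base using (if_then_else_)
open import Data.Nat.Base as ℕ
  using (ℕ; zero; suc; NonZero; NonTrivial; nonTrivial⇒nonZero; nonTrivial⇒n>1; _+_; _*_; _^_; _<_; z≤n; s≤s)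
import Data.Nat.Properties as ℕ
open import Data.Integer.Base as ℤ using (+_; +[1+_]; -[1+_])
import Data.Integer.Properties as ℤ
open import Data.Rational.Base as ℚ using (ℚ; 0ℚ; mkℚ; *<*; ↥_; ↧ₙ_; _/_; _≤_)
import Data.Rational.Properties as ℚ
open import Data.Rational.Unnormalised.Base as ℚᵘ using (mkℚᵘ; *≡*; *≤*)
import Data.Rational.Unnormalised.Properties as ℚᵘ
open import Algebra.Properties.Semiring.Sum ℕ.+-*-semiring
  using (sum; sum-syntax; sum-cong-≗; ∑-comm; *-distribˡ-sum; *-distribʳ-sum)
open import Algebra.Solver.CommutativeMonoid ℕ.*-1-commutativeMonoid
  using (solve; _⊜_) renaming (_⊕_ to infixl 7 _⊕_)
open import Data.Fin.Base using (Fin; zero; suc)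
open import Data.Fin.Properties using (injective⇒≤; ¬∀⟶∃¬)
open import Data.Fin.Subset using (Subset; inside; outside; _∈_; _⊆_; _∩_; ∣_∣)
open import Data.Fin.Subset.Properties using (_∈?_; x∈p∩q⁺; drop-∷-⊆; p∩q⊆p; p∩q⊆q)
open import Data.Vec.Base using (Vec; []; _∷_; here; there; lookup; tabulate; allFin; count; zip)
open import Data.Vec.Properties
  using (lookup-allFin; tabulate∘lookup; tabulate-cong; lookup∘tabulate; count≤n; ∷-injective)
open import Data.List.Base as List using (List; []; _∷_; length; cartesianProduct)
open import Data.List.Membership.Propositional using () renaming (_∈_ to _∈ˡ_)
import Data.List.Membership.Propositional.Properties as ∈ˡ
import Data.List.Relation.Unary.All as All
open import Data.List.Relation.Unary.AllPairs using ([]; _∷_)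
open import Data.List.Relation.Unary.Any as Any using (here; there)
open import Data.List.Relation.Unary.Any.Properties using (lookup-index)
open import Data.List.Relation.Unary.Unique.Propositional using (Unique)
import Data.List.Relation.Unary.Unique.Propositional.Properties as Unique
open import Data.Product.Base using (∃; _×_; _,_; proj₁; proj₂)
open import Data.Sum.Base using (_⊎_; inj₁; inj₂)
open import Function.Base using (_∘_)
open import Function.Bundles using (Bijection; Inverse; mk⇔)
open import Relation.Binary.Construct.Add.Supremum.NonStrict ℚ._≤_
  using ([_]; _≤⊤⁺; [≤]-injective; ≤⁺-trans; ≤⁺-reflexive-≡)
open import Relation.Binary.PropositionalEquality hiding (J)
open import Relation.Nullary using (¬_; Dec; does; yes; no; ¬?; contradiction)
open import Relation.Unary using (Pred; Decidable)

open ℝ≥0 using (Below)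

-- Fractions of natural numbers

/-mono-≤ : ∀ p d p′ d′ .{{_ : NonZero d}} .{{_ : NonZero d′}} →
           p * d′ ℕ.≤ p′ * d → + p / d ℚ.≤ + p′ / d′
/-mono-≤ p d@(suc d-1) p′ d′@(suc d′-1) le = ℚ.toℚᵘ-cancel-≤
  (ℚᵘ.≤-respˡ-≃ (ℚᵘ.≃-sym (ℚ.toℚᵘ-fromℚᵘ (mkℚᵘ (+ p) d-1)))
  (ℚᵘ.≤-respʳ-≃ (ℚᵘ.≃-sym (ℚ.toℚᵘ-fromℚᵘ (mkℚᵘ (+ p′) d′-1)))
  (*≤* (subst₂ ℤ._≤_ (ℤ.pos-* p d′) (ℤ.pos-* p′ d) (ℤ.+≤+ le)))))

/-cancel-≤ : ∀ p d p′ d′ .{{_ : NonZero d}} .{{_ : NonZero d′}} →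
             + p / d ℚ.≤ + p′ / d′ → p * d′ ℕ.≤ p′ * d
/-cancel-≤ p d@(suc d-1) p′ d′@(suc d′-1) le
  with ℚᵘ.≤-respˡ-≃ (ℚ.toℚᵘ-fromℚᵘ (mkℚᵘ (+ p) d-1))
         (ℚᵘ.≤-respʳ-≃ (ℚ.toℚᵘ-fromℚᵘ (mkℚᵘ (+ p′) d′-1)) (ℚ.toℚᵘ-mono-≤ le))
... | *≤* le′ = ℤ.drop‿+≤+ (subst₂ ℤ._≤_ (sym (ℤ.pos-* p d′)) (sym (ℤ.pos-* p′ d)) le′)

/-mono-< : ∀ p d p′ d′ .{{_ : NonZero d}} .{{_ : NonZero d′}} →
           p * d′ < p′ * d → + p / d ℚ.< + p′ / d′
/-mono-< p d p′ d′ lt = ℚ.≰⇒> λ le → ℕ.<⇒≱ lt (/-cancel-≤ p′ d′ p d le)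

/-cancel-< : ∀ p d p′ d′ .{{_ : NonZero d}} .{{_ : NonZero d′}} →
             + p / d ℚ.< + p′ / d′ → p * d′ < p′ * d
/-cancel-< p d p′ d′ lt = ℕ.≰⇒> λ le → ℚ.<-irrefl refl (ℚ.<-≤-trans lt (/-mono-≤ p′ d′ p d le))

/-pos : ∀ p d .{{_ : NonZero p}} .{{_ : NonZero d}} → 0ℚ ℚ.< + p / d
/-pos p@(suc _) d = /-mono-< 0 1 p d (s≤s z≤n)

-- The operation `/` reduces to lowest terms, so the identity is checked among unnormalised
-- rationals, where both sides are the same fraction.
/-* : ∀ p d p′ d′ .{{_ : NonZero d}} .{{_ : NonZero d′}} →
      (+ p / d) ℚ.* (+ p′ / d′) ≡ (+ (p * p′) / (d * d′)) {{ℕ.m*n≢0 d d′}}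
/-* p (suc d) p′ (suc d′) = ℚ.toℚᵘ-injective (begin
  ℚ.toℚᵘ (ℚ.fromℚᵘ u ℚ.* ℚ.fromℚᵘ v)              ≈⟨ ℚ.toℚᵘ-homo-* (ℚ.fromℚᵘ u) (ℚ.fromℚᵘ v) ⟩
  ℚ.toℚᵘ (ℚ.fromℚᵘ u) ℚᵘ.* ℚ.toℚᵘ (ℚ.fromℚᵘ v)    ≈⟨ ℚᵘ.*-cong (ℚ.toℚᵘ-fromℚᵘ u) (ℚ.toℚᵘ-fromℚᵘ v) ⟩
  u ℚᵘ.* v                                        ≡⟨ cong (λ i → mkℚᵘ i (d′ + d * suc d′)) (sym (ℤ.pos-* p p′)) ⟩
  mkℚᵘ (+ (p * p′)) (d′ + d * suc d′)             ≈⟨ ℚ.toℚᵘ-fromℚᵘ _ ⟨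
  ℚ.toℚᵘ (+ (p * p′) / (suc d * suc d′))          ∎)
  where
  open ℚᵘ.≃-Reasoning
  u = mkℚᵘ (+ p) d
  v = mkℚᵘ (+ p′) d′

-- With numerator and denominator as separate natural numbers, membership in the cuts below turns
-- into inequalities between powers.
pos-fraction : ∀ {q} → 0ℚ ℚ.< q → ∃ λ p → ∃ λ d → q ≡ + suc p / suc d
pos-fraction {q@(mkℚ +[1+ p ] d _)} _ = p , d , sym (ℚ.↥p/↧p≡p q)
pos-fraction {mkℚ (+ 0)    _ _} (*<* (ℤ.+<+ ()))
pos-fraction {mkℚ -[1+ _ ] _ _} (*<* ())

nonneg-fraction : ∀ {q} → 0ℚ ℚ.≤ q → ∃ λ p → ∃ λ d → q ≡ + p / suc d
nonneg-fraction {q@(mkℚ (+ p) d _)} _ = p , d , sym (ℚ.↥p/↧p≡p q)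
nonneg-fraction {mkℚ -[1+ _ ] _ _} (ℚ.*≤* ())

-- Logarithms

module _ (b : ℕ) .{{_ : NonTrivial b}} (a p d : ℕ) .{{_ : NonZero d}} where

  private
    instance
      b≢0 : NonZero b
      b≢0 = nonTrivial⇒nonZero b

    -- `Below (log b a)` reads the numerator and denominator in lowest terms, while `p` and `d` may
    -- share a factor. This proportionality is what `pow-<` needs to pass between the two forms.
    cross : ∀ r → r ≡ + p / d → ℤ.∣ ↥ r ∣ * d ≡ p * ↧ₙ r
    cross r refl = helper d r (ℚ.toℚᵘ-cong refl)
      where
      helper : ∀ d .{{_ : NonZero d}} r → ℚ.toℚᵘ r ℚᵘ.≃ ℚ.toℚᵘ (+ p / d) → ℤ.∣ ↥ r ∣ * d ≡ p * ↧ₙ r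
      helper d@(suc d-1) r@record{} eq
        with *≡* e ← ℚᵘ.≃-trans eq (ℚ.toℚᵘ-fromℚᵘ (mkℚᵘ (+ p) d-1)) = begin
        ℤ.∣ ↥ r ∣ * d         ≡⟨ ℤ.abs-* (↥ r) (+ d) ⟨
        ℤ.∣ ↥ r ℤ.* + d ∣     ≡⟨ cong ℤ.∣_∣ e ⟩
        ℤ.∣ + p ℤ.* ℚ.↧ r ∣   ≡⟨ ℤ.abs-* (+ p) (ℚ.↧ r) ⟩
        p * ↧ₙ r              ∎
        where open ≡-Reasoning

  log∋ : .{{_ : NonZero p}} → b ^ p < a ^ d → Below (log b a) (+ p / d)
  log∋ lt = /-pos p d ,
    pow-< b a {p} {d} {ℤ.∣ ↥ (+ p / d) ∣} {↧ₙ (+ p / d)} (ℕ.≤-reflexive (cross (+ p / d) refl)) lt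

  log∋⁻¹ : Below (log b a) (+ p / d) → b ^ p < a ^ d
  log∋⁻¹ (_ , lt) =
    pow-< b a {ℤ.∣ ↥ (+ p / d) ∣} {↧ₙ (+ p / d)} {p} {d} (ℕ.≤-reflexive (sym (cross (+ p / d) refl))) lt

-- Consecutive powers of `c` differ by the factor `c`, so one of them lies above `m` and at most at
-- `c * m`. By induction on `m`, the exponent is kept while its power exceeds the new `m`, and
-- raised by one otherwise.
∃-power : ∀ c .{{_ : NonTrivial c}} m .{{_ : NonZero m}} → ∃ λ e → m < c ^ e × c ^ e ℕ.≤ c * m
∃-power c 1 = 1 , subst (1 <_) (sym (ℕ.*-identityʳ c)) (nonTrivial⇒n>1 c) , ℕ.≤-refl
∃-power c (suc m@(suc _)) with ∃-power c m
... | e , m<cᵉ , cᵉ≤cm with suc m ℕ.<? c ^ e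
...   | yes lt = e , lt , ℕ.≤-trans cᵉ≤cm (ℕ.*-monoʳ-≤ c (ℕ.n≤1+n m))
...   | no ≮ = suc e , ℕ.<-≤-trans (ℕ.m<m*n (suc m) c (nonTrivial⇒n>1 c))
                 (subst (ℕ._≤ c * c ^ e) (ℕ.*-comm c (suc m)) (ℕ.*-monoʳ-≤ c m<cᵉ)) ,
               ℕ.*-monoʳ-≤ c (ℕ.≮⇒≥ ≮)

-- By slack, u ^ K and v ^ K are more than a factor c apart for K = c u.
power-between : ∀ c .{{_ : NonTrivial c}} {u v} .{{_ : NonZero u}} → u < v →
                ∃ λ k → ∃ λ e → u ^ suc k < c ^ suc e × c ^ suc e < v ^ suc k
power-between c@(suc c-1) {u@(suc u-1)} {v} u<v = go (∃-power c (u ^ K) {{ℕ.m^n≢0 u K}})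
  where
  K = c * u
  go : (∃ λ e → u ^ K < c ^ e × c ^ e ℕ.≤ c * u ^ K) →
       ∃ λ k → ∃ λ e → u ^ suc k < c ^ suc e × c ^ suc e < v ^ suc k
  -- `c ^ 0 = 1` cannot exceed `u ^ K`, so the exponent is positive.
  go (zero  , lt , _)  with () ← ℕ.<⇒≱ lt (ℕ.m^n>0 u K)
  -- The first witness is `K` minus one, since `K` is `suc c-1 * suc u-1`.
  go (suc e , lt , le) = u-1 + c-1 * u , e , lt , ℕ.≤-<-trans le (slack c u v u<v)

-- Change of base

module _ (A B : ℕ) .{{_ : NonTrivial A}} .{{_ : NonTrivial B}}
         (n N : ℕ) .{{_ : NonZero n}} .{{_ : NonZero N}} (M : ℕ) where

  private
    instance
      A≢0 : NonZero A
      A≢0 = nonTrivial⇒nonZero A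
      B≢0 : NonZero B
      B≢0 = nonTrivial⇒nonZero B
      Aⁿ-nonTrivial : NonTrivial (A ^ n)
      Aⁿ-nonTrivial = ^-nonTrivial A n
      Bᴺ-nonTrivial : NonTrivial (B ^ N)
      Bᴺ-nonTrivial = ^-nonTrivial B N
      Aⁿ≢0 : NonZero (A ^ n)
      Aⁿ≢0 = ℕ.m^n≢0 A n

    lhs rhs : ℝ≥0
    lhs = log (A ^ n) M
    rhs = fromℚ (+ N / n) · log 2 B ÷ log 2 A [ log₂-pos A ] · log (B ^ N) M

    -- Here `x` and `y` are the factors in the outer product, `β` is the upper bound of log₂ `A`
    -- that witnesses the quotient, and `g`, `l` are the factors in the inner product. All are given
    -- as unreduced fractions, so that every condition is one on natural numbers.
    rhs∋ : ∀ q₁ q₂ x₁ x₂ y₁ y₂ β₁ β₂ g₁ g₂ l₁ l₂ .{{_ : NonZero q₁}} .{{_ : NonZero q₂}}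
      .{{_ : NonZero x₁}} .{{_ : NonZero x₂}} .{{_ : NonZero y₁}} .{{_ : NonZero y₂}}
      .{{_ : NonZero β₁}} .{{_ : NonZero β₂}} .{{_ : NonZero g₁}} .{{_ : NonZero g₂}}
      .{{_ : NonZero l₁}} .{{_ : NonZero l₂}} →
      A ^ β₂ ℕ.≤ 2 ^ β₁ → 2 ^ l₁ < B ^ l₂ → (B ^ N) ^ y₁ < M ^ y₂ →
      q₁ * (x₂ * y₂) ℕ.≤ x₁ * y₁ * q₂ → x₁ * β₁ * (g₂ * l₂) ℕ.≤ g₁ * l₁ * (x₂ * β₂) → g₁ * n < N * g₂ →
      Below rhs (+ q₁ / q₂)
    rhs∋ q₁ q₂ x₁ x₂ y₁ y₂ β₁ β₂ g₁ g₂ l₁ l₂ A≤ <B <M q≤ x≤ g< =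
      /-pos q₁ q₂ , + x₁ / x₂ , + y₁ / y₂ ,
      ( /-pos x₁ x₂ , + β₁ / β₂ , /-pos β₁ β₂ , (λ β∈ → ℕ.<⇒≱ (log∋⁻¹ 2 A β₁ β₂ β∈) A≤)
      , *-pos (/-pos x₁ x₂) (/-pos β₁ β₂) , + g₁ / g₂ , + l₁ / l₂
      , (/-pos g₁ g₂ , /-mono-< g₁ g₂ N n g<) , log∋ 2 B l₁ l₂ <B
      , subst₂ ℚ._≤_ (sym (/-* x₁ x₂ β₁ β₂)) (sym (/-* g₁ g₂ l₁ l₂))
          (/-mono-≤ (x₁ * β₁) (x₂ * β₂) (g₁ * l₁) (g₂ * l₂) x≤) ) ,
      log∋ (B ^ N) M y₁ y₂ <M ,
      subst (+ q₁ / q₂ ℚ.≤_) (sym (/-* x₁ x₂ y₁ y₂))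
        (/-mono-≤ q₁ q₂ (x₁ * y₁) (x₂ * y₂) q≤)
      where
      instance
        xy≢0 : NonZero (x₂ * y₂)
        xy≢0 = ℕ.m*n≢0 x₂ y₂
        xβ≢0 : NonZero (x₂ * β₂)
        xβ≢0 = ℕ.m*n≢0 x₂ β₂
        gl≢0 : NonZero (g₂ * l₂)
        gl≢0 = ℕ.m*n≢0 g₂ l₂

    -- With l = e / (N y K₂ K₃) < log₂ B, β = f / (n p K₁ K₂ K₃) > log₂ A and
    -- g = (N / n) (f / e K₃) < N / n, the quotient g l / β is p K₁ / y.
    assemble : ∀ p d y e f K₁ K₂ K₃ .{{_ : NonZero p}} .{{_ : NonZero d}} .{{_ : NonZero y}}
      .{{_ : NonZero e}} .{{_ : NonZero f}} .{{_ : NonZero K₁}} .{{_ : NonZero K₂}} .{{_ : NonZero K₃}} →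
      (B ^ N) ^ y < (M ^ d) ^ K₁ → 2 ^ e < ((B ^ N) ^ y) ^ K₂ →
      ((((A ^ n) ^ p) ^ K₁) ^ K₂) ^ K₃ < 2 ^ f → 2 ^ f < (2 ^ e) ^ K₃ →
      Below rhs (+ p / d)
    assemble p d y e f K₁ K₂ K₃ y< e< <f f< =
      rhs∋ p d (p * K₁) y y (d * K₁) f (n * p * K₁ * K₂ * K₃) (N * f) (n * (e * K₃)) e (N * y * K₂)
        (ℕ.<⇒≤ (subst (_< 2 ^ f) A-power <f))
        (subst (2 ^ e <_) B-power e<)
        (subst ((B ^ N) ^ y <_) (ℕ.^-*-assoc M d K₁) y<)
        (ℕ.≤-reflexive (r₄ p d y K₁))
        (ℕ.≤-reflexive (r₃ N n p y e f K₁ K₂ K₃))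
        (subst₂ _<_ (r₁ N n f) (r₂ N n (e * K₃)) (ℕ.*-monoʳ-< (N * n) f<eK₃))
      where
      instance
        pK≢0 : NonZero (p * K₁)
        pK≢0 = ℕ.m*n≢0 p K₁
        dK≢0 : NonZero (d * K₁)
        dK≢0 = ℕ.m*n≢0 d K₁
        npK≢0 : NonZero (n * p * K₁ * K₂ * K₃)
        npK≢0 = ℕ.m*n≢0 _ K₃ {{ℕ.m*n≢0 _ K₂ {{ℕ.m*n≢0 _ K₁ {{ℕ.m*n≢0 n p}}}}}}
        Nf≢0 : NonZero (N * f)
        Nf≢0 = ℕ.m*n≢0 N f
        eK≢0 : NonZero (e * K₃)
        eK≢0 = ℕ.m*n≢0 e K₃
        neK≢0 : NonZero (n * (e * K₃))
        neK≢0 = ℕ.m*n≢0 n (e * K₃)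
        Ny≢0 : NonZero (N * y)
        Ny≢0 = ℕ.m*n≢0 N y
        NyK≢0 : NonZero (N * y * K₂)
        NyK≢0 = ℕ.m*n≢0 (N * y) K₂
        Nn≢0 : NonZero (N * n)
        Nn≢0 = ℕ.m*n≢0 N n
      A-power : ((((A ^ n) ^ p) ^ K₁) ^ K₂) ^ K₃ ≡ A ^ (n * p * K₁ * K₂ * K₃)
      A-power rewrite ℕ.^-*-assoc A n p | ℕ.^-*-assoc A (n * p) K₁
        | ℕ.^-*-assoc A (n * p * K₁) K₂ | ℕ.^-*-assoc A (n * p * K₁ * K₂) K₃ = refl
      B-power : ((B ^ N) ^ y) ^ K₂ ≡ B ^ (N * y * K₂)
      B-power rewrite ℕ.^-*-assoc B N y | ℕ.^-*-assoc B (N * y) K₂ = refl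
      f<eK₃ : f < e * K₃
      f<eK₃ = exp-cancel-< 2 (subst (2 ^ f <_) (ℕ.^-*-assoc 2 e K₃) f<)
      r₁ : ∀ N n f → N * n * f ≡ N * f * n
      r₁ = solve 3 (λ N n f → N ⊕ n ⊕ f ⊜ N ⊕ f ⊕ n) refl
      r₂ : ∀ N n x → N * n * x ≡ N * (n * x)
      r₂ = solve 3 (λ N n x → N ⊕ n ⊕ x ⊜ N ⊕ (n ⊕ x)) refl
      r₃ : ∀ N n p y e f K₁ K₂ K₃ →
           p * K₁ * f * (n * (e * K₃) * (N * y * K₂)) ≡ N * f * e * (y * (n * p * K₁ * K₂ * K₃))
      r₃ = solve 9 (λ N n p y e f K₁ K₂ K₃ →
           p ⊕ K₁ ⊕ f ⊕ (n ⊕ (e ⊕ K₃) ⊕ (N ⊕ y ⊕ K₂)) ⊜ N ⊕ f ⊕ e ⊕ (y ⊕ (n ⊕ p ⊕ K₁ ⊕ K₂ ⊕ K₃))) refl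
      r₄ : ∀ p d y K₁ → p * (y * (d * K₁)) ≡ p * K₁ * y * d
      r₄ = solve 4 (λ p d y K₁ → p ⊕ (y ⊕ (d ⊕ K₁)) ⊜ p ⊕ K₁ ⊕ y ⊕ d) refl

    -- The hypotheses say q ≤ x y, x β ≤ g l, g ≤ N / n, log₂ A ≤ β, l < log₂ B and
    -- y < log_{B^N} M, so that n q log₂ A ≤ n x y β ≤ n g l y ≤ N y log₂ B < log₂ M.
    exponent-chain : ∀ q₁ q₂ x₁ x₂ y₁ y₂ β₁ β₂ g₁ g₂ l₁ l₂ .{{_ : NonZero q₂}} .{{_ : NonZero x₂}}
      .{{_ : NonZero β₂}} .{{_ : NonZero g₂}} .{{_ : NonZero l₂}} →
      A ^ β₂ ℕ.≤ 2 ^ β₁ → 2 ^ l₁ < B ^ l₂ → (B ^ N) ^ y₁ < M ^ y₂ →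
      q₁ * (x₂ * y₂) ℕ.≤ x₁ * y₁ * q₂ → x₁ * β₁ * (g₂ * l₂) ℕ.≤ g₁ * l₁ * (x₂ * β₂) → g₁ * n ℕ.≤ N * g₂ →
      (A ^ n) ^ q₁ < M ^ q₂
    exponent-chain q₁ q₂ x₁ x₂ y₁ y₂ β₁ β₂ g₁ g₂ l₁ l₂ A≤ <B <M q≤ x≤ g≤ = base-cancel-< D (begin-strict
      ((A ^ n) ^ q₁) ^ D          ≡⟨ cong (_^ D) (ℕ.^-*-assoc A n q₁) ⟩
      (A ^ (n * q₁)) ^ D          ≡⟨ ℕ.^-*-assoc A (n * q₁) D ⟩
      A ^ (n * q₁ * D)            ≡⟨ cong (A ^_) (r₁ n q₁ β₂ x₂ y₂ g₂ l₂) ⟩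
      A ^ (β₂ * E₁)               ≡⟨ ℕ.^-*-assoc A β₂ E₁ ⟨
      (A ^ β₂) ^ E₁               ≤⟨ ℕ.^-monoˡ-≤ E₁ A≤ ⟩
      (2 ^ β₁) ^ E₁               ≡⟨ ℕ.^-*-assoc 2 β₁ E₁ ⟩
      2 ^ (β₁ * E₁)               ≤⟨ ℕ.^-monoʳ-≤ 2 exponents ⟩
      2 ^ (l₁ * E₂)               ≡⟨ ℕ.^-*-assoc 2 l₁ E₂ ⟨
      (2 ^ l₁) ^ E₂               ≤⟨ ℕ.^-monoˡ-≤ E₂ (ℕ.<⇒≤ <B) ⟩
      (B ^ l₂) ^ E₂               ≡⟨ ℕ.^-*-assoc B l₂ E₂ ⟩
      B ^ (l₂ * E₂)               ≡⟨ cong (B ^_) (r₂ N l₂ g₂ y₁ q₂ x₂ β₂) ⟩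
      B ^ (N * y₁ * E₃)           ≡⟨ ℕ.^-*-assoc B (N * y₁) E₃ ⟨
      (B ^ (N * y₁)) ^ E₃         ≡⟨ cong (_^ E₃) (ℕ.^-*-assoc B N y₁) ⟨
      ((B ^ N) ^ y₁) ^ E₃         <⟨ ℕ.^-monoˡ-< E₃ <M ⟩
      (M ^ y₂) ^ E₃               ≡⟨ ℕ.^-*-assoc M y₂ E₃ ⟩
      M ^ (y₂ * E₃)               ≡⟨ cong (M ^_) (r₃ q₂ y₂ l₂ g₂ x₂ β₂) ⟩
      M ^ (q₂ * D)                ≡⟨ ℕ.^-*-assoc M q₂ D ⟨
      (M ^ q₂) ^ D                ∎)
      where
      open ℕ.≤-Reasoning
      -- `D` is the product of all denominators except `q₂`. Raising both sides to it clears the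
      -- fractions, and `E₁`, `E₂`, `E₃` are the exponents left over when the bounds on `A`, `B` and
      -- `M` are applied. The strict step is the one for `M`, hence `E₃` must be nonzero.
      D  = β₂ * x₂ * y₂ * g₂ * l₂
      E₁ = n * q₁ * x₂ * y₂ * g₂ * l₂
      E₂ = N * g₂ * y₁ * q₂ * x₂ * β₂
      E₃ = q₂ * l₂ * g₂ * x₂ * β₂
      instance
        E₃≢0 : NonZero E₃
        E₃≢0 = ℕ.m*n≢0 _ β₂ {{ℕ.m*n≢0 _ x₂ {{ℕ.m*n≢0 _ g₂ {{ℕ.m*n≢0 q₂ l₂}}}}}}
      r₁ : ∀ n q₁ β₂ x₂ y₂ g₂ l₂ →
           n * q₁ * (β₂ * x₂ * y₂ * g₂ * l₂) ≡ β₂ * (n * q₁ * x₂ * y₂ * g₂ * l₂)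
      r₁ = solve 7 (λ n q₁ β₂ x₂ y₂ g₂ l₂ →
           n ⊕ q₁ ⊕ (β₂ ⊕ x₂ ⊕ y₂ ⊕ g₂ ⊕ l₂) ⊜ β₂ ⊕ (n ⊕ q₁ ⊕ x₂ ⊕ y₂ ⊕ g₂ ⊕ l₂)) refl
      r₂ : ∀ N l₂ g₂ y₁ q₂ x₂ β₂ →
           l₂ * (N * g₂ * y₁ * q₂ * x₂ * β₂) ≡ N * y₁ * (q₂ * l₂ * g₂ * x₂ * β₂)
      r₂ = solve 7 (λ N l₂ g₂ y₁ q₂ x₂ β₂ →
           l₂ ⊕ (N ⊕ g₂ ⊕ y₁ ⊕ q₂ ⊕ x₂ ⊕ β₂) ⊜ N ⊕ y₁ ⊕ (q₂ ⊕ l₂ ⊕ g₂ ⊕ x₂ ⊕ β₂)) refl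
      r₃ : ∀ q₂ y₂ l₂ g₂ x₂ β₂ →
           y₂ * (q₂ * l₂ * g₂ * x₂ * β₂) ≡ q₂ * (β₂ * x₂ * y₂ * g₂ * l₂)
      r₃ = solve 6 (λ q₂ y₂ l₂ g₂ x₂ β₂ →
           y₂ ⊕ (q₂ ⊕ l₂ ⊕ g₂ ⊕ x₂ ⊕ β₂) ⊜ q₂ ⊕ (β₂ ⊕ x₂ ⊕ y₂ ⊕ g₂ ⊕ l₂)) refl
      r₄ : ∀ β₁ n q₁ x₂ y₂ g₂ l₂ →
           β₁ * (n * q₁ * x₂ * y₂ * g₂ * l₂) ≡ q₁ * (x₂ * y₂) * (β₁ * n * g₂ * l₂)
      r₄ = solve 7 (λ β₁ n q₁ x₂ y₂ g₂ l₂ →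
           β₁ ⊕ (n ⊕ q₁ ⊕ x₂ ⊕ y₂ ⊕ g₂ ⊕ l₂) ⊜ q₁ ⊕ (x₂ ⊕ y₂) ⊕ (β₁ ⊕ n ⊕ g₂ ⊕ l₂)) refl
      r₅ : ∀ x₁ y₁ q₂ β₁ n g₂ l₂ →
           x₁ * y₁ * q₂ * (β₁ * n * g₂ * l₂) ≡ x₁ * β₁ * (g₂ * l₂) * (n * y₁ * q₂)
      r₅ = solve 7 (λ x₁ y₁ q₂ β₁ n g₂ l₂ →
           x₁ ⊕ y₁ ⊕ q₂ ⊕ (β₁ ⊕ n ⊕ g₂ ⊕ l₂) ⊜ x₁ ⊕ β₁ ⊕ (g₂ ⊕ l₂) ⊕ (n ⊕ y₁ ⊕ q₂)) refl
      r₆ : ∀ g₁ l₁ x₂ β₂ n y₁ q₂ →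
           g₁ * l₁ * (x₂ * β₂) * (n * y₁ * q₂) ≡ g₁ * n * (l₁ * y₁ * q₂ * x₂ * β₂)
      r₆ = solve 7 (λ g₁ l₁ x₂ β₂ n y₁ q₂ →
           g₁ ⊕ l₁ ⊕ (x₂ ⊕ β₂) ⊕ (n ⊕ y₁ ⊕ q₂) ⊜ g₁ ⊕ n ⊕ (l₁ ⊕ y₁ ⊕ q₂ ⊕ x₂ ⊕ β₂)) refl
      r₇ : ∀ N g₂ l₁ y₁ q₂ x₂ β₂ →
           N * g₂ * (l₁ * y₁ * q₂ * x₂ * β₂) ≡ l₁ * (N * g₂ * y₁ * q₂ * x₂ * β₂)
      r₇ = solve 7 (λ N g₂ l₁ y₁ q₂ x₂ β₂ →
           N ⊕ g₂ ⊕ (l₁ ⊕ y₁ ⊕ q₂ ⊕ x₂ ⊕ β₂) ⊜ l₁ ⊕ (N ⊕ g₂ ⊕ y₁ ⊕ q₂ ⊕ x₂ ⊕ β₂)) refl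
      exponents : β₁ * E₁ ℕ.≤ l₁ * E₂
      exponents = begin
        β₁ * E₁                                    ≡⟨ r₄ β₁ n q₁ x₂ y₂ g₂ l₂ ⟩
        q₁ * (x₂ * y₂) * (β₁ * n * g₂ * l₂)        ≤⟨ ℕ.*-monoˡ-≤ (β₁ * n * g₂ * l₂) q≤ ⟩
        x₁ * y₁ * q₂ * (β₁ * n * g₂ * l₂)          ≡⟨ r₅ x₁ y₁ q₂ β₁ n g₂ l₂ ⟩
        x₁ * β₁ * (g₂ * l₂) * (n * y₁ * q₂)        ≤⟨ ℕ.*-monoˡ-≤ (n * y₁ * q₂) x≤ ⟩
        g₁ * l₁ * (x₂ * β₂) * (n * y₁ * q₂)        ≡⟨ r₆ g₁ l₁ x₂ β₂ n y₁ q₂ ⟩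
        g₁ * n * (l₁ * y₁ * q₂ * x₂ * β₂)          ≤⟨ ℕ.*-monoˡ-≤ (l₁ * y₁ * q₂ * x₂ * β₂) g≤ ⟩
        N * g₂ * (l₁ * y₁ * q₂ * x₂ * β₂)          ≡⟨ r₇ N g₂ l₁ y₁ q₂ x₂ β₂ ⟩
        l₁ * E₂                                    ∎

    chain : ∀ q₁ q₂ x₁ x₂ y₁ y₂ β₁ β₂ g₁ g₂ l₁ l₂ .{{_ : NonZero q₂}} .{{_ : NonZero x₂}}
      .{{_ : NonZero y₂}} .{{_ : NonZero β₁}} .{{_ : NonZero β₂}} .{{_ : NonZero g₂}} .{{_ : NonZero l₂}} →
      ¬ Below (log 2 A) (+ β₁ / β₂) → Below (log 2 B) (+ l₁ / l₂) → Below (log (B ^ N) M) (+ y₁ / y₂) →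
      + q₁ / q₂ ℚ.≤ (+ x₁ / x₂) ℚ.* (+ y₁ / y₂) →
      (+ x₁ / x₂) ℚ.* (+ β₁ / β₂) ℚ.≤ (+ g₁ / g₂) ℚ.* (+ l₁ / l₂) → + g₁ / g₂ ℚ.< + N / n →
      (A ^ n) ^ q₁ < M ^ q₂
    chain q₁ q₂ x₁ x₂ y₁ y₂ β₁ β₂ g₁ g₂ l₁ l₂ β∉ l∈ y∈ q≤ x≤ g< =
      exponent-chain q₁ q₂ x₁ x₂ y₁ y₂ β₁ β₂ g₁ g₂ l₁ l₂
        -- Contrapositive: a `β` that is not below log₂ `A` satisfies `A ^ β₂ ≤ 2 ^ β₁`.
        (ℕ.≮⇒≥ λ lt → β∉ (log∋ 2 A β₁ β₂ lt)) (log∋⁻¹ 2 B l₁ l₂ l∈) (log∋⁻¹ (B ^ N) M y₁ y₂ y∈)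
        (/-cancel-≤ q₁ q₂ (x₁ * y₁) (x₂ * y₂) (subst (+ q₁ / q₂ ℚ.≤_) (/-* x₁ x₂ y₁ y₂) q≤))
        (/-cancel-≤ (x₁ * β₁) (x₂ * β₂) (g₁ * l₁) (g₂ * l₂)
          (subst₂ ℚ._≤_ (/-* x₁ x₂ β₁ β₂) (/-* g₁ g₂ l₁ l₂) x≤))
        (ℕ.<⇒≤ (/-cancel-< g₁ g₂ N n g<))
      where
      instance
        xy≢0 : NonZero (x₂ * y₂)
        xy≢0 = ℕ.m*n≢0 x₂ y₂
        xβ≢0 : NonZero (x₂ * β₂)
        xβ≢0 = ℕ.m*n≢0 x₂ β₂
        gl≢0 : NonZero (g₂ * l₂)
        gl≢0 = ℕ.m*n≢0 g₂ l₂

  log-change-⊆ : ∀ {q} → Below lhs q → Below rhs q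
  log-change-⊆ {q} q∈ = go (pos-fraction (proj₁ q∈)) q∈
    where
    -- Matched as an argument: with-abstraction would normalise the gcds in the goal.
    go : ∀ {q} → (∃ λ p → ∃ λ d → q ≡ + suc p / suc d) → Below lhs q → Below rhs q
    go (p-1 , d-1 , refl) q∈ = assemble p (suc d-1) (suc y) (suc e) (suc f) (suc k₁) (suc k₂) (suc k₃)
      (proj₂ (proj₂ (proj₂ y-bounds))) (proj₂ (proj₂ (proj₂ e-bounds)))
      (proj₁ (proj₂ (proj₂ f-bounds))) (proj₂ (proj₂ (proj₂ f-bounds)))
      where
      p = suc p-1
      u≢0 : NonZero ((A ^ n) ^ p)
      u≢0 = ℕ.m^n≢0 (A ^ n) p
      -- First insertion: a power of `B ^ N` between `(A ^ n) ^ p` and `M ^ d`. Its exponent gives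
      -- the factor taken below the logarithm of `M`.
      y-bounds = power-between (B ^ N) {{Bᴺ-nonTrivial}} {{u≢0}} (log∋⁻¹ (A ^ n) M p (suc d-1) q∈)
      k₁ = proj₁ y-bounds
      y = proj₁ (proj₂ y-bounds)
      u₁≢0 : NonZero (((A ^ n) ^ p) ^ suc k₁)
      u₁≢0 = ℕ.m^n≢0 _ (suc k₁) {{u≢0}}
      -- Second insertion: a power of 2 below that power of `B ^ N`, which gives the rational below
      -- log₂ `B`.
      e-bounds = power-between 2 {{_}} {{u₁≢0}} (proj₁ (proj₂ (proj₂ y-bounds)))
      k₂ = proj₁ e-bounds
      e = proj₁ (proj₂ e-bounds)
      -- Third insertion: a smaller power of 2, still above the power of `A`. It gives the upper
      -- bound for log₂ `A`, and the gap to `2 ^ e` makes the factor `g` strictly less than `N / n`.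
      f-bounds = power-between 2 {{_}} {{ℕ.m^n≢0 _ (suc k₂) {{u₁≢0}}}} (proj₁ (proj₂ (proj₂ e-bounds)))
      k₃ = proj₁ f-bounds
      f = proj₁ (proj₂ f-bounds)

  log-change-⊇ : ∀ {q} → Below rhs q → Below lhs q
  log-change-⊇ (0<q , x , y , (0<x , β , 0<β , β∉ , _ , g , l , (0<g , g<γ) , l∈ , xβ≤gl) , y∈ , q≤xy) =
    go (pos-fraction 0<q) (pos-fraction 0<x) (pos-fraction (proj₁ y∈)) (pos-fraction 0<β)
       (pos-fraction 0<g) (pos-fraction (proj₁ l∈)) β∉ g<γ l∈ xβ≤gl y∈ q≤xy
    where
    Fraction : ℚ → Set
    Fraction q = ∃ λ p → ∃ λ d → q ≡ + suc p / suc d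
    go : ∀ {q x y β g l} → Fraction q → Fraction x → Fraction y → Fraction β → Fraction g → Fraction l →
         ¬ Below (log 2 A) β → g ℚ.< + N / n → Below (log 2 B) l → x ℚ.* β ℚ.≤ g ℚ.* l →
         Below (log (B ^ N) M) y → q ℚ.≤ x ℚ.* y → Below lhs q
    go (q₁ , q₂ , refl) (x₁ , x₂ , refl) (y₁ , y₂ , refl) (β₁ , β₂ , refl) (g₁ , g₂ , refl) (l₁ , l₂ , refl)
       β∉ g<γ l∈ xβ≤gl y∈ q≤xy =
      log∋ (A ^ n) M (suc q₁) (suc q₂)
        (chain (suc q₁) (suc q₂) (suc x₁) (suc x₂) (suc y₁) (suc y₂)
               (suc β₁) (suc β₂) (suc g₁) (suc g₂) (suc l₁) (suc l₂) β∉ l∈ y∈ q≤xy xβ≤gl g<γ)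

  log-change : log (A ^ n) M ≈ fromℚ (+ N / n) · log 2 B ÷ log 2 A [ log₂-pos A ] · log (B ^ N) M
  log-change q = mk⇔ log-change-⊆ log-change-⊇

-- Cardinality and minimum distance of codes

unique-lookup-injective : ∀ {A : Set} {xs : List A} → Unique xs →
                          ∀ i j → List.lookup xs i ≡ List.lookup xs j → i ≡ j
unique-lookup-injective (_ ∷ _)   zero    zero    _  = refl
unique-lookup-injective (x∉ ∷ _)  zero    (suc j) eq = contradiction eq (All.lookup x∉ (∈ˡ.∈-lookup j))
unique-lookup-injective (x∉ ∷ _)  (suc i) zero    eq = contradiction (sym eq) (All.lookup x∉ (∈ˡ.∈-lookup i))
unique-lookup-injective (_ ∷ xs!) (suc i) (suc j) eq = cong suc (unique-lookup-injective xs! i j eq)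

-- Send each position of `xs` to the position in `ys` of a chosen `R`-partner. Equal positions mean
-- the same partner, hence the same element, hence the same position in the duplicate-free `xs`; so
-- the map between finite index sets is injective.
length-≤ : ∀ {A B : Set} (R : A → B → Set) {xs ys} → Unique xs →
           (∀ {x} → x ∈ˡ xs → ∃ λ y → y ∈ˡ ys × R x y) →
           (∀ {x x′ y} → R x y → R x′ y → x ≡ x′) → length xs ℕ.≤ length ys
length-≤ R {xs} {ys} xs! total inj = injective⇒≤ {f = position} position-injective
  where
  image : ∀ i → ∃ λ y → y ∈ˡ ys × R (List.lookup xs i) y
  image i = total (∈ˡ.∈-lookup i)
  position : Fin (length xs) → Fin (length ys)
  position i = Any.index (proj₁ (proj₂ (image i)))
  position-injective : ∀ {i j} → position i ≡ position j → i ≡ j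
  position-injective {i} {j} eq = unique-lookup-injective xs! i j
    (inj (proj₂ (proj₂ (image i))) (subst (R (List.lookup xs j)) (sym same) (proj₂ (proj₂ (image j)))))
    where
    same : proj₁ (image i) ≡ proj₁ (image j)
    same = trans (lookup-index (proj₁ (proj₂ (image i))))
      (trans (cong (List.lookup ys) eq) (sym (lookup-index (proj₁ (proj₂ (image j))))))

module _ (𝔸 : Alphabet) where
  open Alphabet 𝔸 hiding (size)

  ∈-words : ∀ {k} (f : Word k) → f ∈ˡ words k
  ∈-words []      = here refl
  ∈-words (x ∷ f) = ∈ˡ.∈-cartesianProductWith⁺ _∷_
    (subst (_∈ˡ List.map (Inverse.from enumeration) (List.allFin (size 𝔸)))
      (Inverse.strictlyInverseʳ enumeration x)
      (∈ˡ.∈-map⁺ (Inverse.from enumeration) (∈ˡ.∈-allFin (Inverse.to enumeration x))))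
    (∈-words f)

  words-unique : ∀ k → Unique (words k)
  words-unique zero    = All.[] ∷ []
  words-unique (suc k) = Unique.cartesianProductWith⁺ _∷_ ∷-injective
    (Unique.map⁺ from-injective (Unique.allFin⁺ (size 𝔸))) (words-unique k)
    where
    from-injective : ∀ {i j} → Inverse.from enumeration i ≡ Inverse.from enumeration j → i ≡ j
    from-injective {i} {j} eq = trans (sym (Inverse.strictlyInverseˡ enumeration i))
      (trans (cong (Inverse.to enumeration) eq) (Inverse.strictlyInverseˡ enumeration j))

module _ {𝔸 : Alphabet} {k : ℕ} (D : Code 𝔸 k) where
  open Code D using (codewords; member?)

  codewords-unique : Unique codewords
  codewords-unique = Unique.filter⁺ member? (words-unique 𝔸 k)

  ∈-codewords⁺ : ∀ {f} → Member D f → f ∈ˡ codewords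
  ∈-codewords⁺ {f} = ∈ˡ.∈-filter⁺ member? (∈-words 𝔸 f)

  ∈-codewords⁻ : ∀ {f} → f ∈ˡ codewords → Member D f
  ∈-codewords⁻ f∈ = proj₂ (∈ˡ.∈-filter⁻ member? {xs = Alphabet.words 𝔸 k} f∈)

card-≤ : ∀ {𝔸 𝔹 k l} (D : Code 𝔸 k) (E : Code 𝔹 l) (R : Alphabet.Word 𝔸 k → Alphabet.Word 𝔹 l → Set) →
         (∀ {f} → Member D f → ∃ λ g → Member E g × R f g) →
         (∀ {f f′ g} → R f g → R f′ g → f ≡ f′) → card D ℕ.≤ card E
card-≤ D E R total = length-≤ R (codewords-unique D) λ f∈ →
  let g , g∈ , r = total (∈-codewords⁻ D f∈) in g , ∈-codewords⁺ E g∈ , r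

-- Minima in ℚ ∪ {+∞} and the minimum distance

≤⁺-trans′ : ∀ {x y z} → x ≤⁺ y → y ≤⁺ z → x ≤⁺ z
≤⁺-trans′ = ≤⁺-trans ℚ.≤-trans

⊓⁺-lowerˡ : ∀ x y → x ⊓⁺ y ≤⁺ x
⊓⁺-lowerˡ [ p ] [ q ] = [ ℚ.p⊓q≤p p q ]
⊓⁺-lowerˡ [ p ] ⊤⁺    = [ ℚ.≤-refl ]
⊓⁺-lowerˡ ⊤⁺    y     = y ≤⊤⁺

⊓⁺-lowerʳ : ∀ x y → x ⊓⁺ y ≤⁺ y
⊓⁺-lowerʳ [ p ] [ q ] = [ ℚ.p⊓q≤q p q ]
⊓⁺-lowerʳ [ p ] ⊤⁺    = [ p ] ≤⊤⁺
⊓⁺-lowerʳ ⊤⁺    y     = ≤⁺-reflexive-≡ ℚ.≤-reflexive refl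

⊓⁺-sel : ∀ x y → x ⊓⁺ y ≡ x ⊎ x ⊓⁺ y ≡ y
⊓⁺-sel [ p ] [ q ] with ℚ.⊓-sel p q
... | inj₁ eq = inj₁ (cong [_] eq)
... | inj₂ eq = inj₂ (cong [_] eq)
⊓⁺-sel [ p ] ⊤⁺ = inj₁ refl
⊓⁺-sel ⊤⁺    y  = inj₂ refl

min⁺-lower : ∀ {x xs} → x ∈ˡ xs → min⁺ xs ≤⁺ x
min⁺-lower {xs = x ∷ xs} (here refl) = ⊓⁺-lowerˡ x (min⁺ xs)
min⁺-lower {xs = x ∷ xs} (there x∈)  = ≤⁺-trans′ (⊓⁺-lowerʳ x (min⁺ xs)) (min⁺-lower x∈)

min⁺-sel : ∀ xs → min⁺ xs ≡ ⊤⁺ ⊎ min⁺ xs ∈ˡ xs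
min⁺-sel []       = inj₁ refl
min⁺-sel (x ∷ xs) with ⊓⁺-sel x (min⁺ xs) | min⁺-sel xs
... | inj₁ eq | _         = inj₂ (here eq)
... | inj₂ eq | inj₁ ⊤    = inj₁ (trans eq ⊤)
... | inj₂ eq | inj₂ m∈xs = inj₂ (there (subst (_∈ˡ xs) (sym eq) m∈xs))

min⁺-glb : ∀ {y} xs → (∀ {x} → x ∈ˡ xs → y ≤⁺ x) → y ≤⁺ min⁺ xs
min⁺-glb {y} xs y≤ with min⁺-sel xs
... | inj₁ eq = subst (y ≤⁺_) (sym eq) (y ≤⊤⁺)
... | inj₂ m∈ = y≤ m∈

module _ {A : Set} {P : Pred A 0ℓ} (h : A → ℚ ⁺) (P? : Decidable P) (xs : List A) where

  min⁺-map-filter-lower : ∀ {a} → a ∈ˡ xs → P a → min⁺ (List.map h (List.filter P? xs)) ≤⁺ h a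
  min⁺-map-filter-lower a∈ Pa = min⁺-lower (∈ˡ.∈-map⁺ h (∈ˡ.∈-filter⁺ P? a∈ Pa))

  min⁺-map-filter-sel : min⁺ (List.map h (List.filter P? xs)) ≡ ⊤⁺ ⊎
                        ∃ λ a → a ∈ˡ xs × P a × min⁺ (List.map h (List.filter P? xs)) ≡ h a
  min⁺-map-filter-sel with min⁺-sel (List.map h (List.filter P? xs))
  ... | inj₁ eq = inj₁ eq
  ... | inj₂ m∈ =
    let a , a∈ , eq = ∈ˡ.∈-map⁻ h m∈
        a∈xs , Pa = ∈ˡ.∈-filter⁻ P? {xs = xs} a∈
    in inj₂ (a , a∈xs , Pa , eq)

module _ {𝔸 : Alphabet} {k : ℕ} .{{_ : NonZero k}} (D : Code 𝔸 k) where
  open Alphabet 𝔸 using (Word; dist; _≟ʷ_)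
  open Code D using (codewords)

  δ-lower : ∀ {f g} → Member D f → Member D g → f ≢ g → δ D ≤⁺ [ dist f g ]
  δ-lower {f} {g} f∈ g∈ f≢g = min⁺-map-filter-lower
    (λ (f , g) → [ dist f g ]) (λ (f , g) → ¬? (f ≟ʷ g)) (cartesianProduct codewords codewords)
    {f , g} (∈ˡ.∈-cartesianProduct⁺ (∈-codewords⁺ D f∈) (∈-codewords⁺ D g∈)) f≢g

  -- A minimum over a finite list is taken at an entry. The first alternative is that of a code with
  -- a single word, where the list of pairs is empty.
  δ-attained : δ D ≡ ⊤⁺ ⊎ ∃ λ f → ∃ λ g → Member D f × Member D g × f ≢ g × δ D ≡ [ dist f g ]
  δ-attained = unpair (min⁺-map-filter-sel
    (λ (f , g) → [ dist f g ]) (λ (f , g) → ¬? (f ≟ʷ g)) (cartesianProduct codewords codewords))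
    where
    unpair : ∀ {m} → (m ≡ ⊤⁺ ⊎ ∃ λ a → a ∈ˡ cartesianProduct codewords codewords ×
               proj₁ a ≢ proj₂ a × m ≡ [ dist (proj₁ a) (proj₂ a) ]) →
             m ≡ ⊤⁺ ⊎ ∃ λ f → ∃ λ g → Member D f × Member D g × f ≢ g × m ≡ [ dist f g ]
    unpair (inj₁ eq) = inj₁ eq
    unpair (inj₂ ((f , g) , fg∈ , f≢g , eq)) =
      let f∈ , g∈ = ∈ˡ.∈-cartesianProduct⁻ codewords codewords fg∈
      in inj₂ (f , g , ∈-codewords⁻ D f∈ , ∈-codewords⁻ D g∈ , f≢g , eq)

  δ-glb : ∀ {y} → (∀ {f g} → Member D f → Member D g → f ≢ g → y ≤⁺ [ dist f g ]) → y ≤⁺ δ D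
  δ-glb {y} y≤ = bound δ-attained
    where
    bound : ∀ {m} → m ≡ ⊤⁺ ⊎ (∃ λ f → ∃ λ g → Member D f × Member D g × f ≢ g × m ≡ [ dist f g ]) → y ≤⁺ m
    bound (inj₁ refl)                           = y ≤⊤⁺
    bound (inj₂ (f , g , f∈ , g∈ , f≢g , refl)) = y≤ f∈ g∈ f≢g

-- Double counting

minimum-≤ : ∀ {k} .{{_ : NonZero k}} (f : Fin k → ℕ) i → minimum f ℕ.≤ f i
minimum-≤ {suc zero}    f zero    = ℕ.≤-refl
minimum-≤ {suc (suc k)} f zero    = ℕ.m⊓n≤m (f zero) _
minimum-≤ {suc (suc k)} f (suc i) = ℕ.≤-trans (ℕ.m⊓n≤n (f zero) _) (minimum-≤ (f ∘ suc) i)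

≤-maximum : ∀ {k} .{{_ : NonZero k}} (f : Fin k → ℕ) i → f i ℕ.≤ maximum f
≤-maximum {suc zero}    f zero    = ℕ.≤-refl
≤-maximum {suc (suc k)} f zero    = ℕ.m≤m⊔n (f zero) _
≤-maximum {suc (suc k)} f (suc i) = ℕ.≤-trans (≤-maximum (f ∘ suc) i) (ℕ.m≤n⊔m (f zero) _)

sum-mono-≤ : ∀ {n} {f g : Fin n → ℕ} → (∀ i → f i ℕ.≤ g i) → sum f ℕ.≤ sum g
sum-mono-≤ {zero}  f≤g = z≤n
sum-mono-≤ {suc n} f≤g = ℕ.+-mono-≤ (f≤g zero) (sum-mono-≤ (f≤g ∘ suc))

sum-one : ∀ n → sum {n} (λ _ → 1) ≡ n
sum-one zero    = refl
sum-one (suc n) = cong suc (sum-one n)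

𝟙 : ∀ {P : Set} → Dec P → ℕ
𝟙 P? = if does P? then 1 else 0

module _ {A : Set} {P : Pred A 0ℓ} (P? : Decidable P) where

  count-sum : ∀ {n} (v : Vec A n) → count P? v ≡ ∑[ i < n ] 𝟙 (P? (lookup v i))
  count-sum []      = refl
  count-sum (x ∷ v) with P? x
  ... | yes _ = cong suc (count-sum v)
  ... | no  _ = count-sum v

∣s∣-sum : ∀ {n} (s : Subset n) → ∣ s ∣ ≡ ∑[ i < n ] 𝟙 (i ∈? s)
∣s∣-sum []            = refl
∣s∣-sum (inside  ∷ s) = cong suc (∣s∣-sum s)
∣s∣-sum (outside ∷ s) = ∣s∣-sum s

module _ {A : Set} {P : Pred (A × A) 0ℓ} (P? : Decidable P) where

  count-↾ : ∀ {n} (s : Subset n) (f g : Vec A n) →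
            count P? (zip (f ↾ s) (g ↾ s)) ≡ ∑[ i < n ] (𝟙 (i ∈? s) * 𝟙 (P? (lookup f i , lookup g i)))
  count-↾ []            []      []      = refl
  count-↾ (outside ∷ s) (x ∷ f) (y ∷ g) = count-↾ s f g
  count-↾ (inside  ∷ s) (x ∷ f) (y ∷ g) with P? (x , y)
  ... | yes _ = cong suc (count-↾ s f g)
  ... | no  _ = count-↾ s f g

  count-zip-sum : ∀ {n} (f g : Vec A n) → count P? (zip f g) ≡ ∑[ i < n ] 𝟙 (P? (lookup f i , lookup g i))
  count-zip-sum []      []      = refl
  count-zip-sum (x ∷ f) (y ∷ g) with P? (x , y)
  ... | yes _ = cong suc (count-zip-sum f g)
  ... | no  _ = count-zip-sum f g

  count-zip-refl : (∀ x → ¬ P (x , x)) → ∀ {n} (f : Vec A n) → count P? (zip f f) ≡ 0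
  count-zip-refl ¬P []      = refl
  count-zip-refl ¬P (x ∷ f) with P? (x , x)
  ... | yes p = contradiction p (¬P x)
  ... | no  _ = count-zip-refl ¬P f

module _ (𝔸 : Alphabet) where
  open Alphabet 𝔸

  hamming : ∀ {k} → Word k → Word k → ℕ
  hamming f g = count (λ (x , y) → ¬? (x ≟ y)) (zip f g)

  hamming-refl : ∀ {k} (f : Word k) → hamming f f ≡ 0
  hamming-refl = count-zip-refl (λ (x , y) → ¬? (x ≟ y)) (λ x x≢x → x≢x refl)

  hamming-sum : ∀ {k} (f g : Word k) → hamming f g ≡ ∑[ i < k ] 𝟙 (¬? (lookup f i ≟ lookup g i))
  hamming-sum = count-zip-sum (λ (x , y) → ¬? (x ≟ y))

-- Coordinates of restricted words

lookup-ext : ∀ {A : Set} {n} {f g : Vec A n} → (∀ i → lookup f i ≡ lookup g i) → f ≡ g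
lookup-ext {f = f} {g} eq = trans (sym (tabulate∘lookup f)) (trans (tabulate-cong eq) (tabulate∘lookup g))

module _ {A : Set} where

  -- A word on `s` lists its letters in the order of the elements of `s`; the proof of `i ∈ s` tells
  -- which entry belongs to the coordinate `i` of the whole word.
  at : ∀ {n} {s : Subset n} {i} → i ∈ s → Vec A ∣ s ∣ → A
  at                   here       (x ∷ _) = x
  at {s = inside  ∷ _} (there i∈) (_ ∷ u) = at i∈ u
  at {s = outside ∷ _} (there i∈) u       = at i∈ u

  at-↾ : ∀ {n} {s : Subset n} {i} (i∈ : i ∈ s) (f : Vec A n) → at i∈ (f ↾ s) ≡ lookup f i
  at-↾                   here       (x ∷ f) = refl
  at-↾ {s = inside  ∷ _} (there i∈) (_ ∷ f) = at-↾ i∈ f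
  at-↾ {s = outside ∷ _} (there i∈) (_ ∷ f) = at-↾ i∈ f

  -- This turns compatibility on an intersection `S s ∩ S s′` into equality of letters at each
  -- common coordinate.
  at-restrict : ∀ {n} (s t : Subset n) (t⊆s : t ⊆ s) {i} (i∈t : i ∈ t) (i∈s : i ∈ s) u →
                at i∈t (restrict s t t⊆s u) ≡ at i∈s u
  at-restrict (inside  ∷ s) (inside  ∷ t) t⊆s here        here        (x ∷ u) = refl
  at-restrict (inside  ∷ s) (inside  ∷ t) t⊆s (there i∈t) (there i∈s) (x ∷ u) =
    at-restrict s t (drop-∷-⊆ t⊆s) i∈t i∈s u
  at-restrict (inside  ∷ s) (outside ∷ t) t⊆s (there i∈t) (there i∈s) (x ∷ u) =
    at-restrict s t (drop-∷-⊆ t⊆s) i∈t i∈s u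
  at-restrict (outside ∷ s) (outside ∷ t) t⊆s (there i∈t) (there i∈s) u       =
    at-restrict s t (drop-∷-⊆ t⊆s) i∈t i∈s u
  at-restrict (outside ∷ s) (inside  ∷ t) t⊆s _           _           u       with () ← t⊆s here

  at-ext : ∀ {n} (s : Subset n) {u v : Vec A ∣ s ∣} → (∀ {i} (i∈ : i ∈ s) → at i∈ u ≡ at i∈ v) → u ≡ v
  at-ext []            {[]}    {[]}    eq = refl
  at-ext (inside  ∷ s) {x ∷ u} {y ∷ v} eq = cong₂ _∷_ (eq here) (at-ext s (eq ∘ there))
  at-ext (outside ∷ s)                 eq = at-ext s (eq ∘ there)

-- Incidences between coordinates and sets

module _ {𝔸 𝔹 : Alphabet} {n : ℕ} .{{_ : NonZero n}} (X : Lifting 𝔸 𝔹 n) where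
  open Lifting X
  open Alphabet 𝔸 using (_≟_)

  -- Exchange the two sums: for fixed `i` the weight factors out, and the indicators add up to the
  -- degree. The constant weight 1 serves for `γ`, the indicator of differing coordinates for the
  -- distances.
  double-count : ∀ (w : Fin n → ℕ) →
    ∑[ s < ∣S∣ ] (∑[ i < n ] (𝟙 (i ∈? S s) * w i)) ≡ ∑[ i < n ] (degree i * w i)
  double-count w = trans (∑-comm (λ s i → 𝟙 (i ∈? S s) * w i))
    (sum-cong-≗ λ i → trans (sym (*-distribʳ-sum (w i) (λ s → 𝟙 (i ∈? S s)))) (cong (_* w i) (sym (degree-sum i))))
    where
    degree-sum : ∀ i → degree i ≡ ∑[ s < ∣S∣ ] 𝟙 (i ∈? S s)
    degree-sum i = trans (count-sum (λ s → i ∈? S s) (allFin ∣S∣))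
      (sum-cong-≗ λ s → cong (λ s → 𝟙 (i ∈? S s)) (lookup-allFin s))

  ∑-degree-lower : ∀ w → Dₘᵢₙ * sum w ℕ.≤ ∑[ i < n ] (degree i * w i)
  ∑-degree-lower w = subst (ℕ._≤ sum (λ i → degree i * w i)) (sym (*-distribˡ-sum Dₘᵢₙ w))
    (sum-mono-≤ λ i → ℕ.*-monoˡ-≤ (w i) (minimum-≤ degree i))

  ∑-degree-upper : ∀ w → ∑[ i < n ] (degree i * w i) ℕ.≤ Dₘₐₓ * sum w
  ∑-degree-upper w = subst (sum (λ i → degree i * w i) ℕ.≤_) (sym (*-distribˡ-sum Dₘₐₓ w))
    (sum-mono-≤ λ i → ℕ.*-monoˡ-≤ (w i) (≤-maximum degree i))

  ∑∣s∣ : ∑[ s < ∣S∣ ] ∣ S s ∣ ≡ ∑[ i < n ] (degree i * 1)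
  ∑∣s∣ = trans
    (sum-cong-≗ λ s → trans (∣s∣-sum (S s)) (sum-cong-≗ λ i → sym (ℕ.*-identityʳ (𝟙 (i ∈? S s)))))
    (double-count (λ _ → 1))

  -- There are at least `Dₘᵢₙ` incidences per coordinate and at most `kₘₐₓ` per set. Besides
  -- bounding `γ`, this exchanges the normalizations `n` and `∣S∣` of the two distances.
  Dₘᵢₙn≤kₘₐₓ∣S∣ : Dₘᵢₙ * n ℕ.≤ kₘₐₓ * ∣S∣
  Dₘᵢₙn≤kₘₐₓ∣S∣ = begin
    Dₘᵢₙ * n                            ≡⟨ cong (Dₘᵢₙ *_) (sum-one n) ⟨
    Dₘᵢₙ * sum {n} (λ _ → 1)            ≤⟨ ∑-degree-lower (λ _ → 1) ⟩
    ∑[ i < n ] (degree i * 1)           ≡⟨ ∑∣s∣ ⟨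
    ∑[ s < ∣S∣ ] ∣ S s ∣                ≤⟨ sum-mono-≤ (≤-maximum (λ s → ∣ S s ∣)) ⟩
    ∑[ s < ∣S∣ ] kₘₐₓ                   ≡⟨ sum-cong-≗ {∣S∣} (λ _ → sym (ℕ.*-identityʳ kₘₐₓ)) ⟩
    ∑[ s < ∣S∣ ] (kₘₐₓ * 1)             ≡⟨ *-distribˡ-sum {∣S∣} kₘₐₓ (λ _ → 1) ⟨
    kₘₐₓ * sum {∣S∣} (λ _ → 1)          ≡⟨ cong (kₘₐₓ *_) (sum-one ∣S∣) ⟩
    kₘₐₓ * ∣S∣                          ∎
    where open ℕ.≤-Reasoning

  kₘᵢₙ∣S∣≤Dₘₐₓn : kₘᵢₙ * ∣S∣ ℕ.≤ Dₘₐₓ * n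
  kₘᵢₙ∣S∣≤Dₘₐₓn = begin
    kₘᵢₙ * ∣S∣                          ≡⟨ cong (kₘᵢₙ *_) (sum-one ∣S∣) ⟨
    kₘᵢₙ * sum {∣S∣} (λ _ → 1)          ≡⟨ *-distribˡ-sum {∣S∣} kₘᵢₙ (λ _ → 1) ⟩
    ∑[ s < ∣S∣ ] (kₘᵢₙ * 1)             ≡⟨ sum-cong-≗ {∣S∣} (λ _ → ℕ.*-identityʳ kₘᵢₙ) ⟩
    ∑[ s < ∣S∣ ] kₘᵢₙ                   ≤⟨ sum-mono-≤ (minimum-≤ (λ s → ∣ S s ∣)) ⟩
    ∑[ s < ∣S∣ ] ∣ S s ∣                ≡⟨ ∑∣s∣ ⟩
    ∑[ i < n ] (degree i * 1)           ≤⟨ ∑-degree-upper (λ _ → 1) ⟩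
    Dₘₐₓ * sum {n} (λ _ → 1)            ≡⟨ cong (Dₘₐₓ *_) (sum-one n) ⟩
    Dₘₐₓ * n                            ∎
    where open ℕ.≤-Reasoning

  γ-lower : + Dₘᵢₙ / kₘₐₓ ℚ.≤ γ
  γ-lower = /-mono-≤ Dₘᵢₙ kₘₐₓ ∣S∣ n (subst (Dₘᵢₙ * n ℕ.≤_) (ℕ.*-comm kₘₐₓ ∣S∣) Dₘᵢₙn≤kₘₐₓ∣S∣)

  γ-upper : γ ℚ.≤ + Dₘₐₓ / kₘᵢₙ
  γ-upper = /-mono-≤ ∣S∣ n Dₘₐₓ kₘᵢₙ (subst (ℕ._≤ Dₘₐₓ * n) (ℕ.*-comm kₘᵢₙ ∣S∣) kₘᵢₙ∣S∣≤Dₘₐₓn)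

  ∑-local-hamming : ∀ f g → ∑[ s < ∣S∣ ] hamming 𝔸 (f ↾ S s) (g ↾ S s) ≡
                            ∑[ i < n ] (degree i * 𝟙 (¬? (lookup f i ≟ lookup g i)))
  ∑-local-hamming f g = trans (sum-cong-≗ λ s → count-↾ (λ (x , y) → ¬? (x ≟ y)) (S s) f g)
    (double-count λ i → 𝟙 (¬? (lookup f i ≟ lookup g i)))

  local-hamming-lower : ∀ f g → Dₘᵢₙ * hamming 𝔸 f g ℕ.≤ ∑[ s < ∣S∣ ] hamming 𝔸 (f ↾ S s) (g ↾ S s)
  local-hamming-lower f g = subst₂ (λ h t → Dₘᵢₙ * h ℕ.≤ t)
    (sym (hamming-sum 𝔸 f g)) (sym (∑-local-hamming f g)) (∑-degree-lower _)

  local-hamming-upper : ∀ f g → ∑[ s < ∣S∣ ] hamming 𝔸 (f ↾ S s) (g ↾ S s) ℕ.≤ Dₘₐₓ * hamming 𝔸 f g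
  local-hamming-upper f g = subst₂ (λ t h → t ℕ.≤ Dₘₐₓ * h)
    (sym (∑-local-hamming f g)) (sym (hamming-sum 𝔸 f g)) (∑-degree-upper _)

-- Lifted code versus line code

-- For use at a single `s`: `x` is the local distance of two words of `C`, and `P?` decides whether
-- the corresponding words of `L` have the same letter at `s`.
𝟙-upper : ∀ {P : Set} (P? : Dec P) {x k} → (P → x ≡ 0) → x ℕ.≤ k → x ℕ.≤ k * 𝟙 (¬? P?)
𝟙-upper (yes p)         x≡0 _   = ℕ.≤-trans (ℕ.≤-reflexive (x≡0 p)) z≤n
𝟙-upper (no _)  {x} {k} _   x≤k = subst (x ℕ.≤_) (sym (ℕ.*-identityʳ k)) x≤k

𝟙-lower : ∀ {P : Set} (P? : Dec P) {x k} → (¬ P → k ℕ.≤ x) → k * 𝟙 (¬? P?) ℕ.≤ x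
𝟙-lower (yes _) {x} {k} _   = subst (ℕ._≤ x) (sym (ℕ.*-zeroʳ k)) z≤n
𝟙-lower (no ¬p) {x} {k} k≤x = subst (ℕ._≤ x) (sym (ℕ.*-identityʳ k)) (k≤x ¬p)

-- The finite upper bounds on `K` and `D` rule out +∞, so the product is one of rationals; as `a`
-- and `κ` are nonnegative, `D` may then be replaced by `y`.
*⁺-bound : ∀ {K D a u y c} .{{_ : ℚ.NonNegative a}} → [ 0ℚ ] ≤⁺ K → K ≤⁺ [ u ] → D ≤⁺ [ y ] →
           (∀ {κ} → 0ℚ ℚ.≤ κ → K ≡ [ κ ] → a ℚ.* κ ℚ.* y ℚ.≤ c) → [ a ] *⁺ K *⁺ D ≤⁺ [ c ]
*⁺-bound {K = [ κ ]} {a = a} [ 0≤κ ] _ [ x≤y ] bound = [ ℚ.≤-trans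
  (ℚ.*-monoˡ-≤-nonNeg (a ℚ.* κ) {{ℚ.nonNeg*nonNeg⇒nonNeg a κ {{ℚ.nonNegative 0≤κ}}}} x≤y)
  (bound 0≤κ refl) ]

≤-product : ∀ i n a b j N .{{_ : NonZero n}} .{{_ : NonZero b}} .{{_ : NonZero N}} →
            i * (b * N) ℕ.≤ a * j * n → + i / n ℚ.≤ (+ a / b) ℚ.* (+ j / N)
≤-product i n a b j N le = subst (+ i / n ℚ.≤_) (sym (/-* a b j N))
  (/-mono-≤ i n (a * j) (b * N) le)
  where
  instance
    bN≢0 : NonZero (b * N)
    bN≢0 = ℕ.m*n≢0 b N

product-≤ : ∀ a b p d j N i n .{{_ : NonZero b}} .{{_ : NonZero d}} .{{_ : NonZero N}} .{{_ : NonZero n}} →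
            a * p * j * n ℕ.≤ i * (b * d * N) → (+ a / b) ℚ.* (+ p / d) ℚ.* (+ j / N) ℚ.≤ + i / n
product-≤ a b p d j N i n le = subst (ℚ._≤ + i / n)
  (sym (trans (cong (ℚ._* (+ j / N)) (/-* a b p d)) (/-* (a * p) (b * d) j N)))
  (/-mono-≤ (a * p * j) (b * d * N) i n le)
  where
  instance
    bd≢0 : NonZero (b * d)
    bd≢0 = ℕ.m*n≢0 b d
    bdN≢0 : NonZero (b * d * N)
    bdN≢0 = ℕ.m*n≢0 (b * d) N

module _ {𝔸 𝔹 : Alphabet} {n : ℕ} .{{_ : NonZero n}} (X : Lifting 𝔸 𝔹 n)
         (φ : Lifting.Identification X) where
  open Lifting X

  -- The correspondence between `L` and `C`, kept as a relation: the letters of `w` are the names in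
  -- `𝔹` of the local restrictions of `g`. It is used in both directions.
  record Agree (w : Alphabet.Word 𝔹 ∣S∣) (g : Alphabet.Word 𝔸 n) : Set where
    constructor agree
    field local : ∀ s → proj₁ (family φ w s) ≡ g ↾ S s
  open Agree

  -- Surjectivity of `φ s` supplies a name for `g ↾ S s`. The named family is compatible because
  -- both restrictions to an intersection are restrictions of the one word `g`.
  encode : ∀ {g} → Member C g → ∃ λ w → Member (L φ) w × Agree w g
  encode {g} g∈ = w , compatible , agree symbols
    where
    preimage : ∀ s → ∃ λ x → ∀ {z} → z ≡ x → proj₁ (Bijection.to (φ s) z) ≡ g ↾ S s
    preimage s = Bijection.surjective (φ s) (g ↾ S s , g∈ s)
    w : Alphabet.Word 𝔹 ∣S∣
    w = tabulate (proj₁ ∘ preimage)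
    symbols : ∀ s → proj₁ (family φ w s) ≡ g ↾ S s
    symbols s = proj₂ (preimage s) (lookup∘tabulate (proj₁ ∘ preimage) s)
    compatible : Compatible (family φ w)
    compatible s s′ = trans
      (trans (cong (restrict (S s) (S s ∩ S s′) (p∩q⊆p (S s) (S s′))) (symbols s))
             (restrict-↾ _ _ (p∩q⊆p (S s) (S s′)) g))
      (sym (trans (cong (restrict (S s′) (S s ∩ S s′) (p∩q⊆q (S s) (S s′))) (symbols s′))
                  (restrict-↾ _ _ (p∩q⊆q (S s) (S s′)) g)))

  -- Gluing: the letter at `i` is read in the one set that `S-covers` chooses for `i`. By
  -- compatibility every other set containing `i` gives the same letter, so the glued word restricts
  -- to the given family.
  decode : ∀ {w} → Member (L φ) w → ∃ λ g → Member C g × Agree w g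
  decode {w} w∈ = g , (λ s → subst (Member (Cₛ s)) (symbols s) (proj₂ (family φ w s))) , agree symbols
    where
    symbol : Fin n → Alphabet.Letter 𝔸
    symbol i = at (proj₂ (S-covers i)) (proj₁ (family φ w (proj₁ (S-covers i))))
    g = tabulate symbol
    symbols : ∀ s → proj₁ (family φ w s) ≡ g ↾ S s
    symbols s′ = at-ext (S s′) λ {i} i∈s′ →
      let s , i∈s = S-covers i
          i∈∩ = x∈p∩q⁺ (i∈s , i∈s′)
      in begin
        at i∈s′ (proj₁ (family φ w s′))
          ≡⟨ at-restrict (S s′) (S s ∩ S s′) (p∩q⊆q (S s) (S s′)) i∈∩ i∈s′ _ ⟨
        at i∈∩ (restrict (S s′) (S s ∩ S s′) (p∩q⊆q (S s) (S s′)) (proj₁ (family φ w s′)))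
          ≡⟨ cong (at i∈∩) (w∈ s s′) ⟨
        at i∈∩ (restrict (S s) (S s ∩ S s′) (p∩q⊆p (S s) (S s′)) (proj₁ (family φ w s)))
          ≡⟨ at-restrict (S s) (S s ∩ S s′) (p∩q⊆p (S s) (S s′)) i∈∩ i∈s _ ⟩
        symbol i
          ≡⟨ lookup∘tabulate symbol i ⟨
        lookup g i
          ≡⟨ at-↾ i∈s′ g ⟨
        at i∈s′ (g ↾ S s′) ∎
      where open ≡-Reasoning

  ↾-ext : ∀ {f g : Alphabet.Word 𝔸 n} → (∀ s → f ↾ S s ≡ g ↾ S s) → f ≡ g
  ↾-ext {f} {g} eq = lookup-ext λ i → let s , i∈s = S-covers i in
    trans (sym (at-↾ i∈s f)) (trans (cong (at i∈s) (eq s)) (at-↾ i∈s g))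

  module _ {w v f g} (w~f : Agree w f) (v~g : Agree v g) where

    agree-↾ : ∀ s → lookup w s ≡ lookup v s → f ↾ S s ≡ g ↾ S s
    agree-↾ s eq = trans (sym (local w~f s)) (trans (Bijection.cong (φ s) eq) (local v~g s))

    agree-lookup : ∀ s → f ↾ S s ≡ g ↾ S s → lookup w s ≡ lookup v s
    agree-lookup s eq = Bijection.injective (φ s) (trans (local w~f s) (trans eq (sym (local v~g s))))

    agree-functional : w ≡ v → f ≡ g
    agree-functional w≡v = ↾-ext λ s → agree-↾ s (cong (λ w → lookup w s) w≡v)

    agree-injective : f ≡ g → w ≡ v
    agree-injective f≡g = lookup-ext λ s → agree-lookup s (cong (_↾ S s) f≡g)

    differ : Fin ∣S∣ → ℕ
    differ s = 𝟙 (¬? (Alphabet._≟_ 𝔹 (lookup w s) (lookup v s)))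

    -- A set where `w` and `v` agree contains no differing coordinate of `f` and `g`; any other
    -- contains at most its size.
    hamming-upper : Dₘᵢₙ * hamming 𝔸 f g ℕ.≤ kₘₐₓ * hamming 𝔹 w v
    hamming-upper = begin
      Dₘᵢₙ * hamming 𝔸 f g                                ≤⟨ local-hamming-lower X f g ⟩
      ∑[ s < ∣S∣ ] hamming 𝔸 (f ↾ S s) (g ↾ S s)          ≤⟨ sum-mono-≤ pointwise ⟩
      ∑[ s < ∣S∣ ] (kₘₐₓ * differ s)                      ≡⟨ *-distribˡ-sum kₘₐₓ differ ⟨
      kₘₐₓ * ∑[ s < ∣S∣ ] differ s                        ≡⟨ cong (kₘₐₓ *_) (hamming-sum 𝔹 w v) ⟨
      kₘₐₓ * hamming 𝔹 w v                                ∎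
      where
      open ℕ.≤-Reasoning
      pointwise : ∀ s → hamming 𝔸 (f ↾ S s) (g ↾ S s) ℕ.≤ kₘₐₓ * differ s
      pointwise s = 𝟙-upper (Alphabet._≟_ 𝔹 (lookup w s) (lookup v s))
        (λ eq → subst (λ u → hamming 𝔸 (f ↾ S s) u ≡ 0) (agree-↾ s eq) (hamming-refl 𝔸 (f ↾ S s)))
        (ℕ.≤-trans (count≤n _ (zip (f ↾ S s) (g ↾ S s))) (≤-maximum (λ s → ∣ S s ∣) s))

    -- The fraction p/d will be `k̃`; the hypothesis is its bound on the nonzero local distances
    -- with the denominator cleared. Each `s` where `w` and `v` differ then accounts for at least
    -- p/d differing coordinates.
    hamming-lower : ∀ p d → (∀ s → f ↾ S s ≢ g ↾ S s → p ℕ.≤ d * hamming 𝔸 (f ↾ S s) (g ↾ S s)) →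
                    p * hamming 𝔹 w v ℕ.≤ d * (Dₘₐₓ * hamming 𝔸 f g)
    hamming-lower p d p≤ = begin
      p * hamming 𝔹 w v                                   ≡⟨ cong (p *_) (hamming-sum 𝔹 w v) ⟩
      p * ∑[ s < ∣S∣ ] differ s                           ≡⟨ *-distribˡ-sum p differ ⟩
      ∑[ s < ∣S∣ ] (p * differ s)
        ≤⟨ sum-mono-≤ (λ s → 𝟙-lower (Alphabet._≟_ 𝔹 (lookup w s) (lookup v s))
                               λ w≢v → p≤ s (w≢v ∘ agree-lookup s)) ⟩
      ∑[ s < ∣S∣ ] (d * hamming 𝔸 (f ↾ S s) (g ↾ S s))
        ≡⟨ *-distribˡ-sum d (λ s → hamming 𝔸 (f ↾ S s) (g ↾ S s)) ⟨
      d * ∑[ s < ∣S∣ ] hamming 𝔸 (f ↾ S s) (g ↾ S s)      ≤⟨ ℕ.*-monoʳ-≤ d (local-hamming-upper X f g) ⟩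
      d * (Dₘₐₓ * hamming 𝔸 f g)                          ∎
      where open ℕ.≤-Reasoning

  card-C≡card-L : card C ≡ card (L φ)
  card-C≡card-L = ℕ.≤-antisym
    (card-≤ C (L φ) (λ g w → Agree w g) encode (λ w~f w~g → agree-functional w~f w~g refl))
    (card-≤ (L φ) C Agree decode (λ w~f v~f → agree-injective w~f v~f refl))

  -- Needed for multiplication by `k̃` to preserve inequalities, and to write a finite `k̃` as a
  -- fraction of natural numbers.
  k̃-nonneg : [ 0ℚ ] ≤⁺ k̃
  k̃-nonneg = min⁺-glb _ λ x∈ → let s , eq = ∈ˡ.∈-tabulate⁻ x∈ in
    subst ([ 0ℚ ] ≤⁺_) (sym eq) (times s (δ-glb (Cₛ s) λ {f} {g} _ _ _ →
      [ /-mono-≤ 0 1 (hamming 𝔸 f g) ∣ S s ∣ z≤n ]))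
    where
    times : ∀ s {x} → [ 0ℚ ] ≤⁺ x → [ 0ℚ ] ≤⁺ x *⁺ [ + ∣ S s ∣ / 1 ]
    times s {[ x ]} [ 0≤x ] = [ subst (ℚ._≤ x ℚ.* (+ ∣ S s ∣ / 1)) (ℚ.*-zeroˡ (+ ∣ S s ∣ / 1))
      (ℚ.*-monoʳ-≤-nonNeg (+ ∣ S s ∣ / 1) {{ℚ.nonNegative (/-mono-≤ 0 1 ∣ S s ∣ 1 z≤n)}} 0≤x) ]
    times s (_ ≤⊤⁺) = _ ≤⊤⁺

  -- The normalized local distance times `∣ S s ∣` is the number of differing coordinates, and it is
  -- at least the term of `s` in the minimum defining `k̃`.
  k̃-upper : ∀ {f g} → Member C f → Member C g → ∀ s → f ↾ S s ≢ g ↾ S s →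
            k̃ ≤⁺ [ + hamming 𝔸 (f ↾ S s) (g ↾ S s) / 1 ]
  k̃-upper {f} {g} f∈ g∈ s f≢g = ≤⁺-trans′ (min⁺-lower (∈ˡ.∈-tabulate⁺ s))
    (times (δ-lower (Cₛ s) (f∈ s) (g∈ s) f≢g))
    where
    h = hamming 𝔸 (f ↾ S s) (g ↾ S s)
    k = ∣ S s ∣
    times : ∀ {x} → x ≤⁺ [ + h / k ] → x *⁺ [ + k / 1 ] ≤⁺ [ + h / 1 ]
    times [ x≤ ] = [ ℚ.≤-trans
      (ℚ.*-monoʳ-≤-nonNeg (+ k / 1) {{ℚ.nonNegative (/-mono-≤ 0 1 k 1 z≤n)}} x≤)
      (subst (ℚ._≤ + h / 1) (sym (/-* h k k 1))
        (/-mono-≤ (h * k) (k * 1) h 1 {{ℕ.m*n≢0 k 1}} (ℕ.≤-reflexive (ℕ.*-assoc h k 1)))) ]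

  δ-lower-bound : [ (+ Dₘᵢₙ / (Dₘₐₓ * kₘₐₓ)) ] *⁺ k̃ *⁺ δ (L φ) ≤⁺ δ C
  δ-lower-bound = δ-glb C λ {f} {g} f∈ g∈ f≢g → pair f∈ g∈ f≢g
    where
    pair : ∀ {f g} → Member C f → Member C g → f ≢ g →
           [ (+ Dₘᵢₙ / (Dₘₐₓ * kₘₐₓ)) ] *⁺ k̃ *⁺ δ (L φ) ≤⁺ [ + hamming 𝔸 f g / n ]
    pair {f} {g} f∈ g∈ f≢g =
      let w , w∈ , w~f = encode {f} f∈
          v , v∈ , v~g = encode {g} g∈
          -- Since the sets cover all coordinates, `f` and `g` differ on some `s`; through
          -- `k̃-upper` this shows that `k̃` is finite.
          s , f≢ₛg = ¬∀⟶∃¬ _ _ (λ s → Alphabet._≟ʷ_ 𝔸 (f ↾ S s) (g ↾ S s)) (f≢g ∘ ↾-ext {f} {g})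
      in *⁺-bound {{ℚ.nonNegative (/-mono-≤ 0 1 Dₘᵢₙ (Dₘₐₓ * kₘₐₓ) z≤n)}}
        k̃-nonneg (k̃-upper {f} {g} f∈ g∈ s f≢ₛg) (δ-lower (L φ) {w} {v} w∈ v∈ (f≢g ∘ agree-functional w~f v~g))
        λ 0≤κ k̃≡κ → bound w~f v~g (nonneg-fraction 0≤κ)
          λ s f≢ₛg → subst (_≤⁺ [ + hamming 𝔸 (f ↾ S s) (g ↾ S s) / 1 ]) k̃≡κ (k̃-upper {f} {g} f∈ g∈ s f≢ₛg)
      where
      bound : ∀ {w v κ} → Agree w f → Agree v g → (∃ λ p → ∃ λ d → κ ≡ + p / suc d) →
        (∀ s → f ↾ S s ≢ g ↾ S s → [ κ ] ≤⁺ [ + hamming 𝔸 (f ↾ S s) (g ↾ S s) / 1 ]) →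
        (+ Dₘᵢₙ / (Dₘₐₓ * kₘₐₓ)) ℚ.* κ ℚ.* (+ hamming 𝔹 w v / ∣S∣) ℚ.≤ + hamming 𝔸 f g / n
      bound {w} {v} w~f v~g (p , d-1 , refl) κ≤ =
        product-≤ Dₘᵢₙ (Dₘₐₓ * kₘₐₓ) p d J ∣S∣ I n (begin
          Dₘᵢₙ * p * J * n                      ≡⟨ r₁ Dₘᵢₙ p J n ⟩
          -- The first factor compares the numbers of differences, the second converts the
          -- normalization by `n` into that by `∣S∣`.
          p * J * (Dₘᵢₙ * n)                    ≤⟨ ℕ.*-mono-≤ (hamming-lower w~f v~g p d p≤) (Dₘᵢₙn≤kₘₐₓ∣S∣ X) ⟩
          d * (Dₘₐₓ * I) * (kₘₐₓ * ∣S∣)         ≡⟨ r₂ d Dₘₐₓ I kₘₐₓ ∣S∣ ⟩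
          I * (Dₘₐₓ * kₘₐₓ * d * ∣S∣)           ∎)
        where
        open ℕ.≤-Reasoning
        d = suc d-1
        I = hamming 𝔸 f g
        J = hamming 𝔹 w v
        p≤ : ∀ s → f ↾ S s ≢ g ↾ S s → p ℕ.≤ d * hamming 𝔸 (f ↾ S s) (g ↾ S s)
        p≤ s f≢ₛg = subst₂ ℕ._≤_ (ℕ.*-identityʳ p) (ℕ.*-comm (hamming 𝔸 (f ↾ S s) (g ↾ S s)) d)
          (/-cancel-≤ p d (hamming 𝔸 (f ↾ S s) (g ↾ S s)) 1 ([≤]-injective (κ≤ s f≢ₛg)))
        r₁ : ∀ D p J n → D * p * J * n ≡ p * J * (D * n)
        r₁ = solve 4 (λ D p J n → D ⊕ p ⊕ J ⊕ n ⊜ p ⊕ J ⊕ (D ⊕ n)) refl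
        r₂ : ∀ d D I k N → d * (D * I) * (k * N) ≡ I * (D * k * d * N)
        r₂ = solve 5 (λ d D I k N → d ⊕ (D ⊕ I) ⊕ (k ⊕ N) ⊜ I ⊕ (D ⊕ k ⊕ d ⊕ N)) refl

  δ-upper-bound : δ C ≤⁺ [ (+ (Dₘₐₓ * kₘₐₓ) / (Dₘᵢₙ * kₘᵢₙ)) ] *⁺ δ (L φ)
  δ-upper-bound = bound (δ-attained (L φ))
    where
    pair : ∀ {w v f g} → Agree w f → Agree v g →
           + hamming 𝔸 f g / n ℚ.≤ (+ (Dₘₐₓ * kₘₐₓ) / (Dₘᵢₙ * kₘᵢₙ)) ℚ.* (+ hamming 𝔹 w v / ∣S∣)
    pair {w} {v} {f} {g} w~f v~g =
      ≤-product I n (Dₘₐₓ * kₘₐₓ) (Dₘᵢₙ * kₘᵢₙ) J ∣S∣ (begin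
        I * (Dₘᵢₙ * kₘᵢₙ * ∣S∣)         ≡⟨ r₁ I Dₘᵢₙ kₘᵢₙ ∣S∣ ⟩
        -- Again a comparison of counts times a change of normalization, now with the upper bound
        -- `kₘᵢₙ∣S∣≤Dₘₐₓn` on the incidences.
        Dₘᵢₙ * I * (kₘᵢₙ * ∣S∣)         ≤⟨ ℕ.*-mono-≤ (hamming-upper w~f v~g) (kₘᵢₙ∣S∣≤Dₘₐₓn X) ⟩
        kₘₐₓ * J * (Dₘₐₓ * n)           ≡⟨ r₂ kₘₐₓ J Dₘₐₓ n ⟩
        Dₘₐₓ * kₘₐₓ * J * n             ∎)
      where
      open ℕ.≤-Reasoning
      I = hamming 𝔸 f g
      J = hamming 𝔹 w v
      r₁ : ∀ I D k N → I * (D * k * N) ≡ D * I * (k * N)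
      r₁ = solve 4 (λ I D k N → I ⊕ (D ⊕ k ⊕ N) ⊜ D ⊕ I ⊕ (k ⊕ N)) refl
      r₂ : ∀ k J D n → k * J * (D * n) ≡ D * k * J * n
      r₂ = solve 4 (λ k J D n → k ⊕ J ⊕ (D ⊕ n) ⊜ D ⊕ k ⊕ J ⊕ n) refl
    bound : ∀ {x} → x ≡ ⊤⁺ ⊎ (∃ λ w → ∃ λ v → Member (L φ) w × Member (L φ) v × w ≢ v ×
              x ≡ [ + hamming 𝔹 w v / ∣S∣ ]) →
            δ C ≤⁺ [ (+ (Dₘₐₓ * kₘₐₓ) / (Dₘᵢₙ * kₘᵢₙ)) ] *⁺ x
    -- Here `L` has only one word and the right-hand side is +∞.
    bound (inj₁ refl) = _ ≤⊤⁺
    bound (inj₂ (w , v , w∈ , v∈ , w≢v , refl)) =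
      let f , f∈ , w~f = decode {w} w∈
          g , g∈ , v~g = decode {v} v∈
      in ≤⁺-trans′ (δ-lower C {f} {g} f∈ g∈ (w≢v ∘ agree-injective w~f v~g)) [ pair w~f v~g ]

-- `log-change` has the same number `M` on both sides, so it applies with `M` the cardinality of the
-- line code once `card C` has been replaced by it.
rate-identity : ∀ {𝔸 𝔹 n} .{{_ : NonZero n}} (X : Lifting 𝔸 𝔹 n) (let open Lifting X) (φ : Identification) →
  rate C ≈ fromℚ γ · log 2 (size 𝔹) ÷ log 2 (size 𝔸) [ log₂-pos (size 𝔸) ] · rate (L φ)
rate-identity {𝔸} {𝔹} {n} X φ = subst
  (λ M → log (size 𝔸 ^ n) {{^-nonTrivial (size 𝔸) n}} M ≈
         fromℚ γ · log 2 (size 𝔹) ÷ log 2 (size 𝔸) [ log₂-pos (size 𝔸) ] · rate (L φ))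
  (sym (card-C≡card-L X φ)) (log-change (size 𝔸) (size 𝔹) n ∣S∣ (card (L φ)))
  where open Lifting X

proposition3p6 : (𝔸 𝔹 : Alphabet) (n : ℕ) .{{_ : NonZero n}} (X : Lifting 𝔸 𝔹 n) →
    let open Lifting X in
    (φ : Identification) →
    ( rate C ≈ fromℚ γ · log 2 (size 𝔹) ÷ log 2 (size 𝔸) [ log₂-pos (size 𝔸) ] · rate (L φ)
    × (+ Dₘᵢₙ / kₘₐₓ ≤ γ × γ ≤ + Dₘₐₓ / kₘᵢₙ) )
    × ( [ + Dₘᵢₙ / (Dₘₐₓ * kₘₐₓ) ] *⁺ k̃ *⁺ δ (L φ) ≤⁺ δ C
    × δ C ≤⁺ [ + (Dₘₐₓ * kₘₐₓ) / (Dₘᵢₙ * kₘᵢₙ) ] *⁺ δ (L φ) )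
proposition3p6 𝔸 𝔹 n X φ =
  (rate-identity X φ , γ-lower X , γ-upper X) , δ-lower-bound X φ , δ-upper-bound X φ
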